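{- Fix integers $n$ and $d$ such that there exist trees of order $n$ and diameter $d$. Among all trees $T$ of order $n$ and diameter $d$, the minimum of $\xi^d(T)-\xi^c(T)$ is attained by a caterpillar.
   Context: For a vertex $v$ of a tree $T$: $\deg(v)$ is its degree, $\varepsilon(v)=\max_{u} d(v,u)$ its eccentricity, $D(v)=\sum_u d(v,u)$ its total distance ($d$ the path distance). $\xi^c(T)=\sum_v \varepsilon(v)\deg(v)$ and $\xi^d(T)=\sum_v\varepsilon(v)D(v)$. The diameter is the maximum eccentricity. A caterpillar is a tree in which removing all leaves yields a path (possibly empty or a single vertex). -}

module Defs where

open import Data.Bool using (Bool; true; false; if_then_else_; _∧_; _∨_)
open import Data.Nat using (ℕ; zero; suc; _+_; _*_; _⊔_)
open import Data.Fin using (Fin; zero; suc; toℕ; inject₁; fromℕ)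
open import Data.List using (List; map; foldr; allFin)
open import Data.Nat.ListAction using (sum)
open import Data.Bool.ListAction using (any)
open import Data.Product using (Σ; _×_; _,_)
open import Data.Sum using (_⊎_)
open import Data.Integer using (ℤ; +_; _-_)
open import Function.Definitions using (Injective)
open import Relation.Binary.PropositionalEquality using (_≡_; _≢_)
open import Function.Bundles using (_⇔_)

record Graph (n : ℕ) : Set where
  field
    adj   : Fin n → Fin n → Bool
    sym   : ∀ u v → adj u v ≡ adj v u
    irrefl : ∀ v → adj v v ≡ false
open Graph public

eqFin : ∀ {n} → Fin n → Fin n → Bool
eqFin zero zero = true
eqFin zero (suc _) = false
eqFin (suc _) zero = false
eqFin (suc i) (suc j) = eqFin i j

module _ {n : ℕ} (G : Graph n) where

  within : ℕ → Fin n → Fin n → Bool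
  within zero u v = eqFin u v
  within (suc k) u v = within k u v ∨ any (λ w → within k u w ∧ adj G w v) (allFin n)

  Connected : Set
  Connected = ∀ u v → Σ ℕ (λ k → within k u v ≡ true)

  HasCycle : Set
  HasCycle = Σ ℕ λ k → Σ (Fin (3 + k) → Fin n) λ c →
    Injective _≡_ _≡_ c ×
    (∀ (i : Fin (2 + k)) → adj G (c (inject₁ i)) (c (suc i)) ≡ true) ×
    (adj G (c (fromℕ (2 + k))) (c zero) ≡ true)

  IsTree : Set
  IsTree = Connected × (HasCycle → Data.Empty.⊥)
    where import Data.Empty

  -- path distance: least k such that v is reachable from u by a walk of length ≤ k
  -- (searched up to k = n, which suffices for connected graphs on n vertices)
  dist : Fin n → Fin n → ℕ
  dist u v = go n 0
    where
      go : ℕ → ℕ → ℕ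
      go zero k = k
      go (suc f) k = if within k u v then k else go f (suc k)

  deg : Fin n → ℕ
  deg v = sum (map (λ u → if adj G v u then 1 else 0) (allFin n))

  ecc : Fin n → ℕ
  ecc v = foldr _⊔_ 0 (map (dist v) (allFin n))

  totalDist : Fin n → ℕ
  totalDist v = sum (map (dist v) (allFin n))

  diameter : ℕ
  diameter = foldr _⊔_ 0 (map ecc (allFin n))

  xiC : ℕ
  xiC = sum (map (λ v → ecc v * deg v) (allFin n))

  xiD : ℕ
  xiD = sum (map (λ v → ecc v * totalDist v) (allFin n))

  xiDiff : ℤ
  xiDiff = + xiD - + xiC

  -- leaves are vertices of degree 1.  Removing all leaves yields a path
  -- (possibly empty or a single vertex): the non-leaf vertices can be listed
  -- injectively as c 0, …, c (m-1) so that two of them are adjacent in G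
  -- exactly when their indices are consecutive.
  IsCaterpillar : Set
  IsCaterpillar = IsTree × (Σ ℕ λ m → Σ (Fin m → Fin n) λ c →
    Injective _≡_ _≡_ c ×
    (∀ i → deg (c i) ≢ 1) ×
    (∀ v → deg v ≢ 1 → Σ (Fin m) λ i → c i ≡ v) ×
    (∀ i j → (adj G (c i) (c j) ≡ true) ⇔ (toℕ i ≡ suc (toℕ j) ⊎ toℕ j ≡ suc (toℕ i))))

{-# OPTIONS --safe #-}

-- ξᵈ(T) − ξᶜ(T) is the sum over ordered pairs (v , u) of ε(v) g(v , u), where g is the distance
-- except that adjacent pairs count 0.  Fix a diametral path of T and hang every other vertex as a
-- leaf on the path vertex nearest to it.  Distances and eccentricities do not grow, except between
-- adjacent vertices w and u of one branch, which move to distance 2.  If u is the parent of w, the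
-- pairs (w , u) and (u , w) cost at most 2 + 2e each, where e is the eccentricity, within the path,
-- of the path vertex x nearest to w.  But w, at distance at least 2 from x in T, becomes adjacent
-- to x, which saves at least 4 + 2e on (w , x) and 2e on (x , w).  Hence every tree is dominated
-- by a caterpillar carried by its own vertex set, and there are finitely many of those.
module Submission where

open import Data.Bool using (Bool; true; false; if_then_else_; _∧_)
open import Data.Bool.ListAction using (any)
open import Data.Bool.Properties using (T-≡; ¬-not)
open import Data.Empty using (⊥; ⊥-elim)
open import Data.Fin using (Fin; zero; suc; toℕ; fromℕ; fromℕ<; inject₁)
import Data.Fin.Properties as Fin
open import Data.Fin.Relation.Unary.Top using (view; ‵fromℕ; ‵inject₁)
import Data.Integer as ℤ
import Data.Integer.Properties as ℤ
open import Data.List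
  using (List; []; _∷_; [_]; _∷ʳ_; map; foldr; filter; length; lookup; allFin; cartesianProductWith)
import Data.List.Extrema ℤ.≤-totalOrder as Extrema
open import Data.List.Membership.Propositional using (_∈_; find; lose)
open import Data.List.Membership.Propositional.Properties
  using (∈-allFin; ∈-map⁺; ∈-map⁻; ∈-lookup; ∈-filter⁺; ∈-cartesianProductWith⁺; foldr-selective)
open import Data.List.Properties using (map-tabulate; map-cong; length-++)
open import Data.List.Relation.Unary.All as All using (All; []; _∷_)
import Data.List.Relation.Unary.All.Properties as All
open import Data.List.Relation.Unary.AllPairs using ([]; _∷_)
import Data.List.Relation.Unary.AllPairs.Properties as AllPairs
open import Data.List.Relation.Unary.Any using (here; there)
open import Data.List.Relation.Unary.Any.Properties using (any⁺; any⁻)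
open import Data.List.Relation.Unary.Unique.Propositional using (Unique)
open import Data.Nat
open import Data.Nat.ListAction using (sum)
open import Data.Nat.Properties
open import Algebra.Properties.CommutativeSemigroup +-commutativeSemigroup using (interchange; xy∙z≈xz∙y)
open import Data.Product using (Σ; ∃; _×_; _,_; proj₁; proj₂)
open import Data.Sum using (_⊎_; inj₁; inj₂)
open import Data.Vec as Vec using (Vec; []; _∷_)
open import Data.Vec.Properties using (lookup∘tabulate)
open import Defs
open import Function using (_∘_; id)
open import Function.Bundles using (_⇔_; mk⇔; Equivalence)
open import Function.Definitions using (Injective)
open import Relation.Binary.Definitions using (tri<; tri≈; tri>)
import Relation.Binary.PropositionalEquality as ≡
open ≡ using (_≡_; _≢_; refl; cong; cong₂; subst)
open import Relation.Nullary using (Dec; yes; no; does; contradiction)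
open import Relation.Nullary.Decidable using (dec-true; dec-false; map′; ¬?; _×-dec_; _→-dec_)

-- Sums, maxima and path metrics

-- The weights cannot be compared pair by pair, because an edge inside a branch really becomes
-- dearer. Charges repair this: `gains` are added on the caterpillar side and `losses` on the tree
-- side, after which the inequality holds for every ordered pair and needs no subtraction (`pair≤`).
-- The charges cancel in the total, since each vertex at height at least 2 has one parent and one
-- spine vertex and (4 + 2e) + 2e = 2(2 + 2e). There is no slack in this balance. Eccentricities of
-- the two graphs are never compared directly. The path eccentricity e separates them: in the tree a
-- vertex has at least height + e, in the caterpillar at most `attach` + e. As `dist` is a bounded
-- search, both graphs are handled through `PathMetric`, a list of local properties that determines
-- the distance. This is what allows the caterpillar to be defined by a formula for its distance,
-- with edges read off as the pairs at distance 1.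

∑ : ∀ {n} → (Fin n → ℕ) → ℕ
∑ f = sum (map f (allFin _))

sum-mono : ∀ {A : Set} {f g : A → ℕ} → (∀ x → f x ≤ g x) → ∀ xs → sum (map f xs) ≤ sum (map g xs)
sum-mono f≤g []       = z≤n
sum-mono f≤g (x ∷ xs) = +-mono-≤ (f≤g x) (sum-mono f≤g xs)

sum-+ : ∀ {A : Set} (f g : A → ℕ) xs →
  sum (map (λ x → f x + g x) xs) ≡ sum (map f xs) + sum (map g xs)
sum-+ f g []       = refl
sum-+ f g (x ∷ xs) = ≡.trans (cong (f x + g x +_) (sum-+ f g xs)) (interchange (f x) (g x) _ _)

sum-*ˡ : ∀ {A : Set} c (f : A → ℕ) xs → sum (map (λ x → c * f x) xs) ≡ c * sum (map f xs)
sum-*ˡ c f []       = ≡.sym (*-zeroʳ c)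
sum-*ˡ c f (x ∷ xs) = ≡.trans (cong (c * f x +_) (sum-*ˡ c f xs)) (≡.sym (*-distribˡ-+ c (f x) _))

sum-zero : ∀ {A : Set} (xs : List A) → sum (map (λ _ → 0) xs) ≡ 0
sum-zero []       = refl
sum-zero (_ ∷ xs) = sum-zero xs

sum-swap : ∀ {A B : Set} (f : A → B → ℕ) xs ys →
  sum (map (λ x → sum (map (f x) ys)) xs) ≡ sum (map (λ y → sum (map (λ x → f x y) xs)) ys)
sum-swap f []       ys = ≡.sym (sum-zero ys)
sum-swap f (x ∷ xs) ys =
  ≡.trans (cong (sum (map (f x) ys) +_) (sum-swap f xs ys)) (≡.sym (sum-+ (f x) _ ys))

∑-cong : ∀ {n} {f g : Fin n → ℕ} → (∀ i → f i ≡ g i) → ∑ f ≡ ∑ g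
∑-cong f≗g = cong sum (map-cong f≗g (allFin _))

∑-mono : ∀ {n} {f g : Fin n → ℕ} → (∀ i → f i ≤ g i) → ∑ f ≤ ∑ g
∑-mono f≤g = sum-mono f≤g (allFin _)

map-allFin : ∀ {A : Set} {n} (f : Fin (suc n) → A) →
  map f (allFin (suc n)) ≡ f zero ∷ map (f ∘ suc) (allFin n)
map-allFin f = cong (f zero ∷_) (≡.trans (map-tabulate suc f) (≡.sym (map-tabulate id (f ∘ suc))))

-- A point mass: it spreads a charge that belongs to one pair over all pairs, so that charges can be
-- added up by `∑`.
_at_ : ∀ {n} → ℕ → Fin n → Fin n → ℕ
(m at w) u = if does (u Fin.≟ w) then m else 0

at-same : ∀ {n} m (w : Fin n) → (m at w) w ≡ m
at-same m w rewrite dec-true (w Fin.≟ w) refl = refl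

at-other : ∀ {n} m {w u : Fin n} → u ≢ w → (m at w) u ≡ 0
at-other m {w} {u} u≢w rewrite dec-false (u Fin.≟ w) u≢w = refl

at-zero : ∀ {n} (w u : Fin n) → (0 at w) u ≡ 0
at-zero w u with does (u Fin.≟ w)
... | true  = refl
... | false = refl

∑-at : ∀ {n} m (w : Fin n) → ∑ (m at w) ≡ m
∑-at {suc n} m zero    = ≡.trans (cong sum (map-allFin {n = n} (m at zero)))
  (≡.trans (cong (m +_) (sum-zero (allFin n))) (+-identityʳ m))
∑-at {suc n} m (suc w) = ≡.trans (cong sum (map-allFin {n = n} (m at suc w))) (∑-at m w)

⨆ : ∀ {n} → (Fin n → ℕ) → ℕ
⨆ f = foldr _⊔_ 0 (map f (allFin _))

⨆-upper : ∀ {n} (f : Fin n → ℕ) i → f i ≤ ⨆ f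
⨆-upper f i = ∈⇒≤ (∈-map⁺ f (∈-allFin i))
  where
  ∈⇒≤ : ∀ {x xs} → x ∈ xs → x ≤ foldr _⊔_ 0 xs
  ∈⇒≤ (here refl)        = m≤m⊔n _ _
  ∈⇒≤ (there {x = y} x∈) = ≤-trans (∈⇒≤ x∈) (m≤n⊔m y _)

⨆-attained : ∀ {n} (f : Fin n → ℕ) → ⨆ f ≡ 0 ⊎ ∃ λ i → ⨆ f ≡ f i
⨆-attained f with foldr-selective ⊔-sel 0 (map f (allFin _))
... | inj₁ ≡0 = inj₁ ≡0
... | inj₂ ∈map with ∈-map⁻ f ∈map
...   | i , _ , ≡fi = inj₂ (i , ≡fi)

⨆-least : ∀ {n} (f : Fin n → ℕ) {b} → (∀ i → f i ≤ b) → ⨆ f ≤ b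
⨆-least f f≤b with ⨆-attained f
... | inj₁ ≡0        = ≤-trans (≤-reflexive ≡0) z≤n
... | inj₂ (i , ≡fi) = ≤-trans (≤-reflexive ≡fi) (f≤b i)

any-true⁺ : ∀ {A : Set} (p : A → Bool) {x xs} → x ∈ xs → p x ≡ true → any p xs ≡ true
any-true⁺ p x∈xs px = Equivalence.to T-≡ (any⁺ p (lose x∈xs (Equivalence.from T-≡ px)))

any-true⁻ : ∀ {A : Set} (p : A → Bool) xs → any p xs ≡ true → ∃ λ x → p x ≡ true
any-true⁻ p xs eq with find (any⁻ p xs (Equivalence.from T-≡ eq))
... | x , _ , px = x , Equivalence.to T-≡ px

eqFin⇒≡ : ∀ {n} (i j : Fin n) → eqFin i j ≡ true → i ≡ j
eqFin⇒≡ zero    zero    _  = refl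
eqFin⇒≡ (suc i) (suc j) eq = cong suc (eqFin⇒≡ i j eq)

eqFin-refl : ∀ {n} (i : Fin n) → eqFin i i ≡ true
eqFin-refl zero    = refl
eqFin-refl (suc i) = eqFin-refl i

-- The loop of dist is local to its definition, so it has no name here.  Unification recovers
-- it once the successor, the graph and the start index are abstracted to variables.
mutual
  search : ∀ {n} → Graph n → Fin n → Fin n → ℕ → ℕ → ℕ
  search = _

  dist-unfold : ∀ m (G : Graph (suc m)) u v →
    dist G u v ≡ (if eqFin u v then 0 else search G u v m 1)
  dist-unfold m G u v with suc m | G | u | v | 1
  ... | _ | _ | _ | _ | _ = refl

-- Local axioms that single out the graph distance (`dist≡metric`): `step` bounds it above along
-- walks, `back` supplies geodesics. Symmetry and finiteness of the search range are consequences.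
record PathMetric {n} (G : Graph n) (δ : Fin n → Fin n → ℕ) : Set where
  field
    self  : ∀ u → δ u u ≡ 0
    ident : ∀ {u v} → δ u v ≡ 0 → u ≡ v
    step  : ∀ u {w v} → adj G w v ≡ true → δ u v ≤ suc (δ u w)
    back  : ∀ {u v k} → δ u v ≡ suc k → ∃ λ w → δ u w ≡ k × adj G w v ≡ true

module _ {n : ℕ} (G : Graph n) where

  within-weaken : ∀ k u v → within G k u v ≡ true → within G (suc k) u v ≡ true
  within-weaken k u v eq rewrite eq = refl

  within-extend : ∀ k u {w v} → within G k u w ≡ true → adj G w v ≡ true → within G (suc k) u v ≡ true
  within-extend k u {w} {v} kuw wv with within G k u v
  ... | true  = refl
  ... | false = any-true⁺ (λ w → within G k u w ∧ adj G w v) (∈-allFin w) (cong₂ _∧_ kuw wv)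

  within-split : ∀ k u v → within G (suc k) u v ≡ true →
    within G k u v ≡ true ⊎ ∃ λ w → within G k u w ≡ true × adj G w v ≡ true
  within-split k u v eq with within G k u v
  ... | true  = inj₁ refl
  ... | false with any-true⁻ (λ w → within G k u w ∧ adj G w v) (allFin n) eq
  ...   | w , both with within G k u w in kuw | adj G w v in wv
  ...     | true | true = inj₂ (w , kuw , wv)

  module _ {δ : Fin n → Fin n → ℕ} (M : PathMetric G δ) where
    open PathMetric M

    within⇒≤ : ∀ k {u v} → within G k u v ≡ true → δ u v ≤ k
    within⇒≤ zero    {u} {v} eq with eqFin⇒≡ u v eq
    ... | refl = ≤-reflexive (self u)
    within⇒≤ (suc k) {u} {v} eq with within-split k u v eq
    ... | inj₁ kuv            = m≤n⇒m≤1+n (within⇒≤ k kuv)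
    ... | inj₂ (w , kuw , wv) = ≤-trans (step u wv) (s≤s (within⇒≤ k kuw))

    ≤⇒within : ∀ k {u v} → δ u v ≤ k → within G k u v ≡ true
    ≤⇒within zero    {u} {v} le with ident {u} {v} (n≤0⇒n≡0 le)
    ... | refl = eqFin-refl u
    ≤⇒within (suc k) {u} {v} le with m≤n⇒m<n∨m≡n le
    ... | inj₁ (s≤s lt) = within-weaken k u v (≤⇒within k lt)
    ... | inj₂ eq with back eq
    ...   | w , uw≡k , wv = within-extend k u (≤⇒within k (≤-reflexive uw≡k)) wv

    level-inhabited : ∀ {u v} k {j} → δ u v ≡ k → j ≤ k → ∃ λ w → δ u w ≡ j
    level-inhabited {v = v} zero    eq z≤n = v , eq
    level-inhabited {v = v} (suc k) eq j≤ with m≤n⇒m<n∨m≡n j≤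
    ... | inj₂ refl      = v , eq
    ... | inj₁ (s≤s j≤k) with back eq
    ...   | w , uw≡k , _ = level-inhabited k uw≡k j≤k

    -- Descending from `v` by `back` meets each of the distances 0, ..., `δ u v`, necessarily at
    -- different vertices. Hence the cut-off of `dist` at `n` is harmless.
    metric<order : ∀ u v → δ u v < n
    metric<order u v = Fin.injective⇒≤ {f = proj₁ ∘ at-level} injective
      where
      at-level : (i : Fin (suc (δ u v))) → ∃ λ w → δ u w ≡ toℕ i
      at-level i = level-inhabited (δ u v) refl (Fin.toℕ≤pred[n] i)
      injective : Injective _≡_ _≡_ (proj₁ ∘ at-level)
      injective {i} {j} eq = Fin.toℕ-injective
        (≡.trans (≡.sym (proj₂ (at-level i))) (≡.trans (cong (δ u) eq) (proj₂ (at-level j))))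

    -- The two inequalities are the loop invariant: the answer has not been passed, and the fuel `f`
    -- still reaches it.
    search≡metric : ∀ u v f k → k ≤ δ u v → δ u v ≤ f + k → search G u v f k ≡ δ u v
    search≡metric u v zero    k lo hi = ≤-antisym lo hi
    search≡metric u v (suc f) k lo hi with within G k u v in eq
    ... | true  = ≤-antisym lo (within⇒≤ k eq)
    ... | false = search≡metric u v f (suc k)
                    (≰⇒> λ le → case-true (≡.trans (≡.sym eq) (≤⇒within k le)))
                    (≤-trans hi (≤-reflexive (≡.sym (+-suc f k))))
      where
      case-true : false ≡ true → ⊥
      case-true ()

    dist≡metric : ∀ u v → dist G u v ≡ δ u v
    dist≡metric u v = search≡metric u v n 0 z≤n
      (≤-trans (<⇒≤ (metric<order u v)) (≤-reflexive (≡.sym (+-identityʳ n))))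

  module _ (connected : Connected G) where

    least : ∀ u v k → within G k u v ≡ true →
      ∃ λ m → within G m u v ≡ true × (∀ j → within G j u v ≡ true → m ≤ j)
    least u v zero    eq = zero , eq , λ _ _ → z≤n
    least u v (suc k) eq with within G k u v in kuv
    ... | true  = least u v k kuv
    ... | false = suc k , within-eq , minimal
      where
      within-eq : within G (suc k) u v ≡ true
      within-eq rewrite kuv = eq
      lift : ∀ {j} i → within G j u v ≡ true → within G (i + j) u v ≡ true
      lift zero    e = e
      lift (suc i) e = within-weaken (i + _) u v (lift i e)
      minimal : ∀ j → within G j u v ≡ true → suc k ≤ j
      minimal j e = ≰⇒> λ j≤k → contradiction
        (≡.trans (≡.sym kuv) (subst (λ i → within G i u v ≡ true) (m∸n+n≡m j≤k) (lift (k ∸ j) e)))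
        λ ()

    shortest : ∀ u v → ∃ λ m → within G m u v ≡ true × (∀ j → within G j u v ≡ true → m ≤ j)
    shortest u v = least u v (proj₁ (connected u v)) (proj₂ (connected u v))

    -- A provisional distance. That `dist` stops in time is known only once some `PathMetric`
    -- exists; connectedness provides this one, and its axioms are then carried over to `dist`.
    leastWalk : Fin n → Fin n → ℕ
    leastWalk u v = proj₁ (shortest u v)

    leastWalk-metric : PathMetric G leastWalk
    leastWalk-metric = record
      { self  = λ u → n≤0⇒n≡0 (minimal u u 0 (eqFin-refl u))
      ; ident = λ {u} {v} eq → eqFin⇒≡ u v (attained u v eq)
      ; step  = λ u {w} {v} wv → minimal u v _ (within-extend (leastWalk u w) u (attained u w refl) wv)
      ; back  = λ {u} {v} {k} eq → back u v k eq
      }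
      where
      attained : ∀ u v {k} → leastWalk u v ≡ k → within G k u v ≡ true
      attained u v refl = proj₁ (proj₂ (shortest u v))
      minimal : ∀ u v j → within G j u v ≡ true → leastWalk u v ≤ j
      minimal u v = proj₂ (proj₂ (shortest u v))
      back : ∀ u v k → leastWalk u v ≡ suc k → ∃ λ w → leastWalk u w ≡ k × adj G w v ≡ true
      back u v k eq with within-split k u v (attained u v eq)
      ... | inj₁ kuv = contradiction (≤-trans (≤-reflexive (≡.sym eq)) (minimal u v k kuv)) (<-irrefl refl)
      ... | inj₂ (w , kuw , wv) = w , ≤-antisym (minimal u w k kuw)
              (s≤s⁻¹ (≤-trans (≤-reflexive (≡.sym eq))
                (minimal u v _ (within-extend (leastWalk u w) u (attained u w refl) wv)))) , wv

    dist-metric : PathMetric G (dist G)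
    dist-metric = record
      { self  = λ u → ≡.trans (≡δ u u) (self u)
      ; ident = λ {u} {v} eq → ident (≡.trans (≡.sym (≡δ u v)) eq)
      ; step  = λ u {w} {v} wv → ≡.subst₂ (λ a b → a ≤ suc b) (≡.sym (≡δ u v)) (≡.sym (≡δ u w)) (step u wv)
      ; back  = λ {u} {v} eq → let w , uw , wv = back (≡.trans (≡.sym (≡δ u v)) eq)
                               in w , ≡.trans (≡δ u w) uw , wv
      }
      where
      open PathMetric leastWalk-metric
      ≡δ = dist≡metric leastWalk-metric

  module _ {δ : Fin n → Fin n → ℕ} (M : PathMetric G δ) where
    open PathMetric M

    -- The axioms move only the second argument. Induction along a geodesic moves the first, and
    -- symmetry follows by reversing geodesics.
    step-source : ∀ k {u w v} → δ w v ≡ k → adj G u w ≡ true → δ u v ≤ suc k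
    step-source zero    {u} eq uw with ident eq
    ... | refl = ≤-trans (step u uw) (≤-reflexive (cong suc (self u)))
    step-source (suc k) {u} eq uw with back eq
    ... | x , wx≡k , xv = ≤-trans (step u xv) (s≤s (step-source k wx≡k uw))

    metric-sym-≤ : ∀ k {u v} → δ v u ≡ k → δ u v ≤ k
    metric-sym-≤ zero    eq with ident eq
    ... | refl = ≤-reflexive (self _)
    metric-sym-≤ (suc k) {u} {v} eq with back eq
    ... | w , vw≡k , wu = ≤-trans (step-source _ refl (≡.trans (sym G u w) wu)) (s≤s (metric-sym-≤ k vw≡k))

    metric-sym : ∀ u v → δ u v ≡ δ v u
    metric-sym u v = ≤-antisym (metric-sym-≤ _ refl) (metric-sym-≤ _ refl)

    adj⇒1 : ∀ {u v} → adj G u v ≡ true → δ u v ≡ 1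
    adj⇒1 {u} {v} uv with δ u v in eq
    ... | zero = contradiction (≡.trans (≡.sym uv) (subst (λ x → adj G u x ≡ false) (ident eq) (irrefl G u))) λ ()
    ... | suc zero = refl
    ... | suc (suc k) = contradiction
      (≤-trans (≤-reflexive (≡.sym eq)) (≤-trans (step u uv) (≤-reflexive (cong suc (self u)))))
                          λ { (s≤s ()) }

    1⇒adj : ∀ {u v} → δ u v ≡ 1 → adj G u v ≡ true
    1⇒adj eq with back eq
    ... | w , uw≡0 , wv with ident uw≡0
    ...   | refl = wv

-- Distance levels in acyclic graphs

Unique⇒lookup-injective : ∀ {A : Set} {xs : List A} → Unique xs → Injective _≡_ _≡_ (lookup xs)
Unique⇒lookup-injective {xs = x ∷ xs} (x∉ ∷ _) {zero}  {zero}  _  = refl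
Unique⇒lookup-injective {xs = x ∷ xs} (x∉ ∷ _) {zero}  {suc j} eq =
  contradiction eq (All.lookup x∉ (∈-lookup j))
Unique⇒lookup-injective {xs = x ∷ xs} (x∉ ∷ _) {suc i} {zero}  eq =
  contradiction (≡.sym eq) (All.lookup x∉ (∈-lookup i))
Unique⇒lookup-injective {xs = x ∷ xs} (_ ∷ u)  {suc i} {suc j} eq = cong suc (Unique⇒lookup-injective u eq)

module _ {n : ℕ} (G : Graph n) where

  private
    V = Fin n
    _~_ : V → V → Set
    u ~ v = adj G u v ≡ true

  ~-sym : ∀ {u v} → u ~ v → v ~ u
  ~-sym {u} {v} uv = ≡.trans (sym G v u) uv

  ~⇒≢ : ∀ {u v} → u ~ v → u ≢ v
  ~⇒≢ {u} uv refl with ≡.trans (≡.sym uv) (irrefl G u)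
  ... | ()

  -- The list omits the start and includes the end, so `a ∷ xs` is the full vertex sequence, in the
  -- shape that `HasCycle` asks for.
  data Chain : V → List V → V → Set where
    []  : ∀ {a} → Chain a [] a
    _∷_ : ∀ {a x xs b} → a ~ x → Chain x xs b → Chain a (x ∷ xs) b

  extend : ∀ {a xs b c} → Chain a xs b → b ~ c → Chain a (xs ∷ʳ c) c
  extend []       bc = bc ∷ []
  extend (e ∷ ch) bc = e ∷ extend ch bc

  chain-consecutive : ∀ {a xs b} → Chain a xs b →
    (i : Fin (length xs)) → lookup (a ∷ xs) (inject₁ i) ~ lookup (a ∷ xs) (suc i)
  chain-consecutive (e ∷ ch) zero    = e
  chain-consecutive (e ∷ ch) (suc i) = chain-consecutive ch i

  chain-end : ∀ {a xs b} → Chain a xs b → lookup (a ∷ xs) (fromℕ (length xs)) ≡ b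
  chain-end []       = refl
  chain-end (e ∷ ch) = chain-end ch

  closed-chain⇒cycle : ∀ {a xs b} → Chain a xs b → Unique (a ∷ xs) → b ~ a → 2 ≤ length xs → HasCycle G
  closed-chain⇒cycle {a} {x ∷ y ∷ zs} ch distinct ba _ =
    length zs , lookup (a ∷ x ∷ y ∷ zs) , Unique⇒lookup-injective distinct , chain-consecutive ch ,
    ≡.trans (cong (λ z → adj G z a) (chain-end ch)) ba
  closed-chain⇒cycle {xs = []}     _ _ _ ()
  closed-chain⇒cycle {xs = x ∷ []} _ _ _ (s≤s ())

  module Levels (acyclic : HasCycle G → ⊥) {δ : V → V → ℕ} (M : PathMetric G δ) (r : V) where
    open PathMetric M

    -- Follow parents from both ends until the two branches meet.
    chain-below : ∀ k {a b} → δ r a ≡ k → δ r b ≡ k →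
      ∃ λ xs → Chain a xs b × Unique (a ∷ xs) × All (λ x → δ r x ≤ k) (a ∷ xs) × (a ≢ b → 2 ≤ length xs)
    chain-below k {a} {b} ra rb with a Fin.≟ b
    ... | yes refl = [] , [] , [] ∷ [] , ≤-reflexive ra ∷ [] , λ a≢a → contradiction refl a≢a
    chain-below zero    ra rb | no a≢b = contradiction (≡.trans (≡.sym (ident ra)) (ident rb)) a≢b
    chain-below (suc k) {a} {b} ra rb | no a≢b with back ra | back rb
    ... | a′ , ra′ , a′a | b′ , rb′ , b′b with chain-below k ra′ rb′
    ...   | xs , ch , distinct , low , _ =
      -- `a` and `b` lie at level `suc k`, above the whole inner chain, so both are fresh. The
      -- entries `a′` and `b` give length 2 even if `a′` and `b′` coincide.
      a′ ∷ xs ∷ʳ b , (~-sym a′a ∷ extend ch b′b)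
      , (All.∷ʳ⁺ (All.map (lower⇒≢ ra) low) a≢b
         ∷ AllPairs.++⁺ distinct ([] ∷ []) (All.map (λ x≤k → (lower⇒≢ rb x≤k ∘ ≡.sym) ∷ []) low))
      , (≤-reflexive ra ∷ All.∷ʳ⁺ (All.map m≤n⇒m≤1+n low) (≤-reflexive rb))
      , λ _ → s≤s (≤-trans (m≤n+m 1 (length xs)) (≤-reflexive (≡.sym (length-++ xs))))
      where
      lower⇒≢ : ∀ {c x} → δ r c ≡ suc k → δ r x ≤ k → c ≢ x
      lower⇒≢ rc x≤k refl = <⇒≱ (s≤s x≤k) (≤-reflexive (≡.sym rc))

    -- An edge inside a level would close the chain below that level into a cycle.
    adjacent⇒levels≢ : ∀ {u v} → u ~ v → δ r u ≢ δ r v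
    adjacent⇒levels≢ uv eq with chain-below _ refl (≡.sym eq)
    ... | xs , ch , distinct , _ , long = acyclic (closed-chain⇒cycle ch distinct (~-sym uv) (long (~⇒≢ uv)))

    -- Two different lower neighbours would be joined by a chain avoiding the higher vertex `v`, and
    -- `v` would close it into a cycle.
    lower-neighbour-unique : ∀ {u w v} → u ~ v → w ~ v → δ r v ≡ suc (δ r u) → δ r v ≡ suc (δ r w) → u ≡ w
    lower-neighbour-unique {u} {w} {v} uv wv vu vw with u Fin.≟ w
    ... | yes eq = eq
    ... | no u≢w with chain-below (δ r u) refl (suc-injective (≡.trans (≡.sym vw) vu))
    ...   | xs , ch , distinct , low , long = ⊥-elim (acyclic
      (closed-chain⇒cycle (~-sym uv ∷ ch)
        (All.map (λ { x≤ refl → <⇒≱ (s≤s x≤) (≤-reflexive (≡.sym vu)) }) low ∷ distinct)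
        wv (m≤n⇒m≤1+n (long u≢w))))

    levels-differ-by-one : ∀ {u v} → u ~ v → δ r v ≡ suc (δ r u) ⊎ δ r u ≡ suc (δ r v)
    levels-differ-by-one {u} {v} uv with <-cmp (δ r u) (δ r v)
    ... | tri< lt _ _ = inj₁ (≤-antisym (step r uv) lt)
    ... | tri≈ _ eq _ = contradiction eq (adjacent⇒levels≢ uv)
    ... | tri> _ _ gt = inj₂ (≤-antisym (step r (~-sym uv)) gt)

    -- A path that moves away from `r` cannot turn back: a descent after `v` would give `v` a second
    -- lower neighbour.
    keeps-ascending : ∀ {u v w} → u ~ v → v ~ w → u ≢ w → δ r v ≡ suc (δ r u) → δ r w ≡ suc (δ r v)
    keeps-ascending uv vw u≢w up with levels-differ-by-one vw
    ... | inj₁ up′  = up′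
    ... | inj₂ down = contradiction (lower-neighbour-unique uv (~-sym vw) up down) u≢w

  -- A highest vertex of a cycle would have two lower neighbours.
  levels⇒acyclic : (H : V → ℕ) → (∀ {u v} → u ~ v → H u ≢ H v) →
    (∀ {u w v} → u ~ v → w ~ v → H u < H v → H w < H v → u ≡ w) → HasCycle G → ⊥
  levels⇒acyclic H H≢ unique (k , c , inj , consecutive , closing) = refute top
    where
    top : ∃ λ i → ∀ j → H (c j) ≤ H (c i)
    top with ⨆-attained (H ∘ c)
    ... | inj₁ ≡0 = zero , λ j → ≤-trans (⨆-upper (H ∘ c) j) (≤-trans (≤-reflexive ≡0) z≤n)
    ... | inj₂ (i , eq) = i , λ j → ≤-trans (⨆-upper (H ∘ c) j) (≤-reflexive eq)

    two-neighbours : ∀ i → ∃ λ j → ∃ λ l → c j ~ c i × c l ~ c i × j ≢ l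
    two-neighbours zero    = suc zero , fromℕ (2 + k) , ~-sym (consecutive zero) , closing , λ ()
    two-neighbours (suc i) with view i
    ... | ‵fromℕ = inject₁ (fromℕ (suc k)) , zero , consecutive (fromℕ (suc k)) , ~-sym closing , λ ()
    ... | ‵inject₁ j = inject₁ (inject₁ j) , suc (suc j) , consecutive (inject₁ j) , ~-sym (consecutive (suc j)) ,
          λ eq → m≢1+n+m (toℕ j) {1} (≡.trans (≡.sym (≡.trans (Fin.toℕ-inject₁ _) (Fin.toℕ-inject₁ j))) (cong toℕ eq))

    refute : (∃ λ i → ∀ j → H (c j) ≤ H (c i)) → ⊥
    refute (i , max) with two-neighbours i
    ... | j , l , ji , li , j≢l =
      j≢l (inj (unique ji li (≤∧≢⇒< (max j) (H≢ ji)) (≤∧≢⇒< (max l) (H≢ li))))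

-- Projection of a tree onto a diametral path

-- The choices are stored in a vector rather than a function because the frames are later looked up
-- in a finite list, where membership is propositional equality.
choose : ∀ {n} {A : Set} {P : Fin n → A → Set} → (∀ i → ∃ (P i)) →
  ∃ λ (xs : Vec A n) → ∀ i → P i (Vec.lookup xs i)
choose {P = P} f = Vec.tabulate (proj₁ ∘ f) ,
  λ i → subst (P i) (≡.sym (lookup∘tabulate (proj₁ ∘ f) i)) (proj₂ (f i))

next-toward : ∀ {n} (i j : Fin n) → i ≢ j → ∃ λ (k : Fin n) →
  ∣ toℕ k - toℕ i ∣ ≡ 1 × ∣ toℕ j - toℕ i ∣ ≡ suc ∣ toℕ j - toℕ k ∣
next-toward zero    zero    i≢j = contradiction refl i≢j
next-toward zero    (suc zero) _ = suc zero , refl , refl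
next-toward zero    (suc (suc j)) _ = suc zero , refl , refl
next-toward (suc zero) zero _ = zero , refl , refl
next-toward (suc (suc i)) zero _ = inject₁ (suc i)
          , ≡.trans (cong (λ m → ∣ m - suc (toℕ i) ∣) (Fin.toℕ-inject₁ i)) (∣n-1+n∣ (toℕ i))
          , cong (λ m → suc (suc m)) (≡.sym (Fin.toℕ-inject₁ i))
  where
  ∣n-1+n∣ : ∀ n → ∣ n - suc n ∣ ≡ 1
  ∣n-1+n∣ zero    = refl
  ∣n-1+n∣ (suc n) = ∣n-1+n∣ n
next-toward (suc i) (suc j) i≢j with next-toward i j (i≢j ∘ cong suc)
... | k , ki , ji = suc k , ki , ji

-- Meant for the distances from one vertex to the successive vertices of a path. Steps of size one
-- without a peak allow only a descent followed by an ascent; the valley `p` will be the projection.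
v-shape : ∀ d (f : ℕ → ℕ) →
  (∀ i → i < d → f (suc i) ≡ suc (f i) ⊎ f i ≡ suc (f (suc i))) →
  (∀ i → suc i < d → f (suc i) ≡ suc (f i) → f (suc (suc i)) ≡ suc (f (suc i))) →
  ∃ λ p → p ≤ d × (∀ j → j ≤ d → f j ≡ f p + ∣ p - j ∣)
v-shape zero    f ±1 no-peak = zero , z≤n , λ { zero _ → ≡.sym (+-identityʳ (f 0)) }
v-shape (suc d) f ±1 no-peak
  with v-shape d (f ∘ suc) (λ i i<d → ±1 (suc i) (s≤s i<d)) (λ i i<d → no-peak (suc i) (s≤s i<d)) | ±1 0 z<s
... | p , p≤d , f≡ | inj₂ down = suc p , s≤s p≤d , λ
  { zero    _         → ≡.trans down (≡.trans (cong suc (f≡ 0 z≤n))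
      (≡.trans (cong (λ m → suc (f (suc p) + m)) (∣-∣-identityʳ p)) (≡.sym (+-suc _ p))))
  ; (suc j) (s≤s j≤d) → f≡ j j≤d }
... | zero , _ , f≡ | inj₁ up = zero , z≤n , λ
  { zero    _         → ≡.sym (+-identityʳ (f 0))
  ; (suc j) (s≤s j≤d) → ≡.trans (f≡ j j≤d) (≡.trans (cong (_+ j) up) (≡.sym (+-suc (f 0) j))) }
-- An upward first step before a tail that starts by descending would make a peak at index 1.
... | suc p , s≤s p≤d , f≡ | inj₁ up = contradiction
  (≡.trans (≡.sym (f≡ 1 (s≤s z≤n))) (≡.trans (no-peak 0 (s≤s (s≤s z≤n)) up) (cong suc (f≡ 0 z≤n))))
  (<⇒≢ (s≤s (+-monoʳ-≤ (f (2 + p)) (≤-trans (≤-reflexive (∣-∣-identityʳ p)) (n≤1+n p)))))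

-- inner keeps leaves off the ends of the spine; otherwise the diameter would exceed d.
record Frame {n d : ℕ} (s : Fin (suc d) → Fin n) (p : Fin n → Fin (suc d)) : Set where
  field
    p∘s   : ∀ i → p (s i) ≡ i
    inner : ∀ u → s (p u) ≢ u → 0 < toℕ (p u) × toℕ (p u) < d

module TreeFrame {n : ℕ} (T : Graph n) (acyclic : HasCycle T → ⊥)
  {δ : Fin n → Fin n → ℕ} (M : PathMetric T δ) where
  open PathMetric M
  open Levels T acyclic M

  private
    V = Fin n

  module _ (a : V) where

    parent-exists : ∀ v → ∃ λ w → δ a w ≡ pred (δ a v) × (δ a v ≢ 0 → adj T w v ≡ true)
    parent-exists v with δ a v in eq
    -- The root is its own parent by default, which agrees with `pred 0` being 0.
    ... | zero  = v , eq , λ ≢0 → contradiction refl ≢0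
    ... | suc k = let w , aw , wv = back eq in w , aw , λ _ → wv

    parent : V → V
    parent v = proj₁ (parent-exists v)

    parent-level : ∀ v → δ a (parent v) ≡ pred (δ a v)
    parent-level v = proj₁ (proj₂ (parent-exists v))

    parent-adj : ∀ v → δ a v ≢ 0 → adj T (parent v) v ≡ true
    parent-adj v = proj₂ (proj₂ (parent-exists v))

    -- Up to index `δ a b` this runs through the path from `b` back to `a`.
    ancestor : V → ℕ → V
    ancestor b zero    = b
    ancestor b (suc i) = parent (ancestor b i)

    ancestor-level : ∀ b i → δ a (ancestor b i) ≡ δ a b ∸ i
    ancestor-level b zero    = refl
    ancestor-level b (suc i) = ≡.trans (parent-level (ancestor b i))
      (≡.trans (cong pred (ancestor-level b i)) (pred[m∸n]≡m∸[1+n] (δ a b) i))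

    ancestor-adj : ∀ b i → i < δ a b → adj T (ancestor b i) (ancestor b (suc i)) ≡ true
    ancestor-adj b i i<d = ~-sym T (parent-adj (ancestor b i)
      λ ≡0 → m>n⇒m∸n≢0 i<d (≡.trans (≡.sym (ancestor-level b i)) ≡0))

    ancestor-≢ : ∀ b i → suc i < δ a b → ancestor b i ≢ ancestor b (suc (suc i))
    ancestor-≢ b i i<d eq = <⇒≢ (∸-monoʳ-< {δ a b} {2 + i} {i} (m≤n+m (suc i) 1) i<d)
      (≡.trans (≡.sym (ancestor-level b (suc (suc i)))) (≡.trans (cong (δ a) (≡.sym eq)) (ancestor-level b i)))

    project : ∀ b u → ∃ λ p → p ≤ δ a b ×
      (∀ j → j ≤ δ a b → δ u (ancestor b j) ≡ δ u (ancestor b p) + ∣ p - j ∣)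
    project b u = v-shape (δ a b) (δ u ∘ ancestor b)
      (λ i i<d → levels-differ-by-one u (ancestor-adj b i i<d))
      (λ i i<d → keeps-ascending u (ancestor-adj b i (<⇒≤ i<d)) (ancestor-adj b (suc i) i<d) (ancestor-≢ b i i<d))

  -- The spine vertex `s (p u)` is the gate from `u` to the entire spine. Applied to spine vertices
  -- themselves, this alone forces `p (s i)` to be `i` and the spine to be isometric to a path
  -- (`spine-δ`).
  Projects : ∀ {d} → (Fin (suc d) → V) → (V → Fin (suc d)) → Set
  Projects s p = ∀ u j → δ u (s j) ≡ δ u (s (p u)) + ∣ toℕ (p u) - toℕ j ∣

  projection : ∀ a b → ∃ λ (ss : Vec V (suc (δ a b))) → ∃ λ (ps : Vec (Fin (suc (δ a b))) n) →
    Projects (Vec.lookup ss) (Vec.lookup ps)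
  projection a b with choose {P = λ i x → x ≡ ancestor a b (toℕ i)} (λ i → ancestor a b (toℕ i) , refl)
  ... | ss , ss≡ = ss , choose
    {P = λ u i → ∀ j → δ u (Vec.lookup ss j) ≡ δ u (Vec.lookup ss i) + ∣ toℕ i - toℕ j ∣}
    λ u → let p , p≤d , eq = project a b u in
    fromℕ< (s≤s p≤d) , λ j → ≡.trans (cong (δ u) (ss≡ j)) (≡.trans (eq (toℕ j) (Fin.toℕ≤pred[n] j))
      (cong₂ (λ x i → δ u x + ∣ i - toℕ j ∣)
        (≡.sym (≡.trans (ss≡ _) (cong (ancestor a b) (Fin.toℕ-fromℕ< (s≤s p≤d)))))
        (≡.sym (Fin.toℕ-fromℕ< (s≤s p≤d)))))

  module Branches {d : ℕ} {s : Fin (suc d) → V} {p : V → Fin (suc d)} (proj : Projects s p)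
    (δ≤d : ∀ u v → δ u v ≤ d) where

    height : V → ℕ
    height u = δ u (s (p u))

    spine-δ : ∀ i j → δ (s i) (s j) ≡ ∣ toℕ i - toℕ j ∣
    spine-projection : ∀ i → height (s i) ≡ 0 × p (s i) ≡ i
    spine-projection i = m+n≡0⇒m≡0 _ sum≡0 , Fin.toℕ-injective (∣m-n∣≡0⇒m≡n (m+n≡0⇒n≡0 (height (s i)) sum≡0))
      where
      sum≡0 : height (s i) + ∣ toℕ (p (s i)) - toℕ i ∣ ≡ 0
      sum≡0 = ≡.trans (≡.sym (proj (s i) i)) (self (s i))
    spine-δ i j with spine-projection i
    ... | h≡0 , pi≡i = ≡.trans (proj (s i) j) (cong₂ (λ h k → h + ∣ toℕ k - toℕ j ∣) h≡0 pi≡i)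

    off-spine⇒height>0 : ∀ u → s (p u) ≢ u → 0 < height u
    off-spine⇒height>0 u off = n≢0⇒n>0 λ ≡0 → off (≡.sym (ident ≡0))

    frame : Frame s p
    frame = record { p∘s = proj₂ ∘ spine-projection ; inner = λ u off → low u off , high u off }
      where
      exceeds : ∀ u j → s (p u) ≢ u → ∣ toℕ (p u) - toℕ j ∣ ≢ d
      exceeds u j off eq = <⇒≱ (≤-trans (+-monoˡ-≤ d (off-spine⇒height>0 u off))
        (≤-reflexive (≡.sym (≡.trans (proj u j) (cong (height u +_) eq))))) (δ≤d u (s j))
      low : ∀ u → s (p u) ≢ u → 0 < toℕ (p u)
      low u off = n≢0⇒n>0 λ ≡0 → exceeds u (fromℕ d) off
        (≡.trans (cong (λ m → ∣ m - toℕ (fromℕ d) ∣) ≡0) (Fin.toℕ-fromℕ d))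
      high : ∀ u → s (p u) ≢ u → toℕ (p u) < d
      high u off = ≤∧≢⇒< (Fin.toℕ≤pred[n] (p u)) λ ≡d → exceeds u zero off
        (≡.trans (∣-∣-identityʳ _) ≡d)
    open Frame frame

    -- If the projections of `y` and `y′` were `gap` apart, then `y′` would be at distance k - gap
    -- from its own spine vertex, and `y` at distance k + 1 + gap from that same vertex. One edge
    -- changes a distance by at most 1, so `gap` is 0.
    descend : ∀ {y k} → δ (s (p y)) y ≡ suc k → ∃ λ y′ → δ (s (p y)) y′ ≡ k × adj T y′ y ≡ true × p y′ ≡ p y
    descend {y} {k} eq with back eq
    ... | y′ , eq′ , y′y = y′ , eq′ , y′y ,
      Fin.toℕ-injective (∣m-n∣≡0⇒m≡n (m+n≡0⇒m≡0 gap (n≤0⇒n≡0 (+-cancelˡ-≤ (height y′) (gap + gap) 0 bound))))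
      where
      open ≤-Reasoning
      gap = ∣ toℕ (p y′) - toℕ (p y) ∣
      bound : height y′ + (gap + gap) ≤ height y′ + 0
      bound = s≤s⁻¹ (begin
        suc (height y′ + (gap + gap))    ≡⟨ cong suc (+-assoc (height y′) gap gap) ⟨
        suc (height y′ + gap + gap)      ≡⟨ cong (λ m → suc m + gap) (proj y′ (p y)) ⟨
        suc (δ y′ (s (p y))) + gap       ≡⟨ cong (λ m → suc m + gap) (≡.trans (metric-sym T M _ _) eq′) ⟩
        suc k + gap                      ≡⟨ cong (_+ gap) (≡.trans (metric-sym T M _ _) eq) ⟨
        height y + gap                   ≡⟨ cong (height y +_) (∣-∣-comm (toℕ (p y′)) (toℕ (p y))) ⟩
        height y + ∣ toℕ (p y) - toℕ (p y′) ∣  ≡⟨ proj y (p y′) ⟨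
        δ y (s (p y′))                   ≤⟨ step-source T M _ refl (~-sym T y′y) ⟩
        suc (height y′)                  ≡⟨ cong suc (+-identityʳ (height y′)) ⟨
        suc (height y′ + 0)              ∎)

    -- Induction on the height of `y`: a path from `u` enters the branch through its spine vertex
    -- and, already ascending there, keeps ascending up to `y`.
    leaving-branch : ∀ u k {y} → p u ≢ p y → δ (s (p y)) y ≡ suc k →
      ∃ λ y′ → δ (s (p y)) y′ ≡ k × adj T y′ y ≡ true × δ u y ≡ suc (δ u y′) × δ u y ≡ δ u (s (p y)) + suc k
    -- The spine neighbour `s j` of `x` in the direction of `u` is nearer to `u` than `x`, so the
    -- path is ascending when it reaches `x`.
    leaving-branch u zero {y} u≢y eq with next-toward (p y) (p u) (u≢y ∘ ≡.sym) | ident (proj₁ (proj₂ (descend eq)))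
    ... | j , j~q , closer | x≡y′ = x , self x , xy , up , ≡.trans up (≡.sym (+-comm (δ u x) 1))
      where
      x = s (p y)
      xy : adj T x y ≡ true
      xy = subst (λ z → adj T z y ≡ true) (≡.sym x≡y′) (proj₁ (proj₂ (proj₂ (descend eq))))
      sj≢y : s j ≢ y
      sj≢y eq′ = contradiction (≡.trans (≡.sym j~q)
        (m≡n⇒∣m-n∣≡0 (cong toℕ (≡.trans (≡.sym (p∘s j)) (cong p eq′))))) λ ()
      up : δ u y ≡ suc (δ u x)
      up = keeps-ascending u (1⇒adj T M (≡.trans (spine-δ j (p y)) j~q)) xy sj≢y
        (≡.trans (proj u (p y)) (≡.trans (cong (height u +_) closer)
          (≡.trans (+-suc (height u) _) (cong suc (≡.sym (proj u j))))))
    leaving-branch u (suc k) {y} u≢y eq with descend eq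
    ... | y′ , eq′ , y′y , py′
      with leaving-branch u k {y′} (u≢y ∘ λ e → ≡.trans e py′) (≡.trans (cong (λ i → δ (s i) y′) py′) eq′)
    ...   | y″ , eq″ , y″y′ , up′ , total = y′ , eq′ , y′y , up , ≡.trans up (≡.trans (cong suc total)
              (≡.trans (cong (λ i → suc (δ u (s i) + suc k)) py′) (≡.sym (+-suc _ (suc k)))))
      where
      y″≢y : y″ ≢ y
      y″≢y refl = contradiction
        (≡.trans (≡.sym eq″) (≡.trans (cong (λ i → δ (s i) y) py′) eq)) (<⇒≢ (m≤n+m (suc k) 1))
      up = keeps-ascending u y″y′ y′y y″≢y up′

    -- The caterpillar distance has the same form with `attach` in place of `height`; this is why
    -- distances between different branches do not grow.
    cross-δ : ∀ u w → p u ≢ p w → δ u w ≡ height u + ∣ toℕ (p u) - toℕ (p w) ∣ + height w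
    cross-δ u w u≢w with δ (s (p w)) w in eq
    ... | zero rewrite ≡.trans (metric-sym T M w (s (p w))) eq =
            ≡.trans (cong (δ u) (≡.sym (ident eq))) (≡.trans (proj u (p w)) (≡.sym (+-identityʳ _)))
    ... | suc k with leaving-branch u k u≢w eq
    ...   | _ , _ , _ , _ , total = ≡.trans total
            (cong₂ _+_ (proj u (p w)) (≡.sym (≡.trans (metric-sym T M w (s (p w))) eq)))

-- Caterpillars given by a spine and an attachment map

does-true : ∀ {P : Set} (P? : Dec P) → does P? ≡ true → P
does-true (yes p) _ = p

gap≡1⇔ : ∀ a b → ∣ a - b ∣ ≡ 1 ⇔ (a ≡ suc b ⊎ b ≡ suc a)
gap≡1⇔ a b = mk⇔ (to a b) (from a b)
  where
  to : ∀ a b → ∣ a - b ∣ ≡ 1 → a ≡ suc b ⊎ b ≡ suc a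
  to (suc zero) zero       refl = inj₁ refl
  to zero       (suc zero) refl = inj₂ refl
  to (suc a)    (suc b)    eq with to a b eq
  ... | inj₁ e = inj₁ (cong suc e)
  ... | inj₂ e = inj₂ (cong suc e)
  ∣1+n-n∣ : ∀ n → ∣ suc n - n ∣ ≡ 1
  ∣1+n-n∣ zero    = refl
  ∣1+n-n∣ (suc n) = ∣1+n-n∣ n
  from : ∀ a b → a ≡ suc b ⊎ b ≡ suc a → ∣ a - b ∣ ≡ 1
  from a b (inj₁ refl) = ∣1+n-n∣ b
  from a b (inj₂ refl) = ≡.trans (∣-∣-comm a (suc a)) (∣1+n-n∣ a)

-- The eccentricity of vertex `i` in the path with vertices 0, ..., `d`.
pathEcc : ℕ → ℕ → ℕ
pathEcc d i = i ⊔ (d ∸ i)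

gap≤pathEcc : ∀ {d} i {j} → j ≤ d → ∣ i - j ∣ ≤ pathEcc d i
gap≤pathEcc {d} i {j} j≤d with ∣m-n∣≡[m∸n]∨[n∸m] i j
... | inj₁ eq = ≤-trans (≤-reflexive eq) (≤-trans (m∸n≤m i j) (m≤m⊔n i _))
... | inj₂ eq = ≤-trans (≤-reflexive eq) (≤-trans (∸-monoˡ-≤ i j≤d) (m≤n⊔m i _))

-- Strictness at inner `j` absorbs the extra edge to a leaf hung there, so such leaves do not raise
-- the eccentricity of other vertices.
gap<pathEcc : ∀ {d} i {j} → i ≤ d → 0 < j → j < d → ∣ i - j ∣ < pathEcc d i
gap<pathEcc {d} i {j} i≤d 0<j j<d with ≤-total j i
... | inj₁ j≤i = <-≤-trans (≤-<-trans (≤-reflexive (≡.trans (∣-∣-comm i j) (m≤n⇒∣m-n∣≡n∸m j≤i)))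
                   (∸-monoʳ-< 0<j j≤i)) (m≤m⊔n i _)
... | inj₂ i≤j = <-≤-trans (≤-<-trans (≤-reflexive (m≤n⇒∣m-n∣≡n∸m i≤j))
                   (∸-monoˡ-< j<d i≤j)) (m≤n⊔m i _)

module _ {n : ℕ} (G : Graph n) where

  private
    indicator : Fin n → Fin n → ℕ
    indicator v u = if adj G v u then 1 else 0

  indicator-adj : ∀ {v u} → adj G v u ≡ true → indicator v u ≡ 1
  indicator-adj eq rewrite eq = refl

  indicator-nonadj : ∀ {v u} → adj G v u ≢ true → indicator v u ≡ 0
  indicator-nonadj ≢true rewrite ¬-not ≢true = refl

  deg≡1 : ∀ v w → adj G v w ≡ true → (∀ u → adj G v u ≡ true → u ≡ w) → deg G v ≡ 1
  deg≡1 v w vw unique = ≡.trans (∑-cong pointwise) (∑-at 1 w)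
    where
    pointwise : ∀ u → indicator v u ≡ (1 at w) u
    pointwise u with u Fin.≟ w
    ... | yes refl = indicator-adj vw
    ... | no u≢w   = indicator-nonadj (u≢w ∘ unique u)

  deg≢1 : ∀ v w x → adj G v w ≡ true → adj G v x ≡ true → w ≢ x → deg G v ≢ 1
  deg≢1 v w x vw vx w≢x eq = <⇒≱ (s≤s (≤-reflexive eq))
    (≤-trans (≤-reflexive (≡.sym (≡.trans (sum-+ (1 at w) (1 at x) (allFin n)) (cong₂ _+_ (∑-at 1 w) (∑-at 1 x)))))
      (∑-mono pointwise))
    where
    pointwise : ∀ u → (1 at w) u + (1 at x) u ≤ indicator v u
    pointwise u with u Fin.≟ w
    ... | yes refl = ≤-reflexive (≡.trans (cong suc (at-other 1 w≢x)) (≡.sym (indicator-adj vw)))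
    ... | no u≢w with u Fin.≟ x
    ...   | yes refl = ≤-reflexive (≡.sym (indicator-adj vx))
    ...   | no u≢x   = z≤n

  deg≡0 : ∀ v → (∀ u → adj G v u ≢ true) → deg G v ≡ 0
  deg≡0 v none = ≡.trans (∑-cong (indicator-nonadj ∘ none)) (sum-zero (allFin n))

module Attachment {n d : ℕ} (s : Fin (suc d) → Fin n) (p : Fin n → Fin (suc d)) where

  attach : Fin n → ℕ
  attach u = if does (s (p u) Fin.≟ u) then 0 else 1

  attach-on : ∀ {u} → s (p u) ≡ u → attach u ≡ 0
  attach-on {u} on rewrite dec-true (s (p u) Fin.≟ u) on = refl

  attach-off : ∀ {u} → s (p u) ≢ u → attach u ≡ 1
  attach-off {u} off rewrite dec-false (s (p u) Fin.≟ u) off = refl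

  -- Equal arguments are treated apart because the sum would give 2 for a leaf and itself.
  cdist : Fin n → Fin n → ℕ
  cdist u v = if does (u Fin.≟ v) then 0 else attach u + attach v + ∣ toℕ (p u) - toℕ (p v) ∣

  cdist-self : ∀ u → cdist u u ≡ 0
  cdist-self u rewrite dec-true (u Fin.≟ u) refl = refl

  cdist-≢ : ∀ {u v} → u ≢ v → cdist u v ≡ attach u + attach v + ∣ toℕ (p u) - toℕ (p v) ∣
  cdist-≢ {u} {v} u≢v rewrite dec-false (u Fin.≟ v) u≢v = refl

  cdist-sym : ∀ u v → cdist u v ≡ cdist v u
  cdist-sym u v with u Fin.≟ v
  ... | yes refl = ≡.sym (cdist-self u)
  ... | no u≢v   = ≡.trans
    (cong₂ _+_ (+-comm (attach u) (attach v)) (∣-∣-comm (toℕ (p u)) (toℕ (p v))))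
    (≡.sym (cdist-≢ (u≢v ∘ ≡.sym)))

  -- Edges are the pairs at cdist 1: consecutive spine vertices, and u with s (p u) off the spine.
  caterpillar : Graph n
  caterpillar = record
    { adj    = λ u v → does (cdist u v ≟ 1)
    ; sym    = λ u v → cong (λ m → does (m ≟ 1)) (cdist-sym u v)
    ; irrefl = λ v → cong (λ m → does (m ≟ 1)) (cdist-self v)
    }

  cdist≡1⇒adj : ∀ {u v} → cdist u v ≡ 1 → adj caterpillar u v ≡ true
  cdist≡1⇒adj eq = dec-true (_ ≟ 1) eq

  adj⇒cdist≡1 : ∀ {u v} → adj caterpillar u v ≡ true → cdist u v ≡ 1
  adj⇒cdist≡1 = does-true (_ ≟ 1)

module CaterpillarProperties {n d : ℕ} {s : Fin (suc d) → Fin n} {p : Fin n → Fin (suc d)} (F : Frame s p) where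
  open Frame F
  open Attachment s p

  private
    V = Fin n

  data Position : V → Set where
    spine : ∀ i → Position (s i)
    leaf  : ∀ {u} → s (p u) ≢ u → Position u

  position : ∀ u → Position u
  position u with s (p u) Fin.≟ u
  ... | yes on = subst Position on (spine (p u))
  ... | no off = leaf off

  attach-s : ∀ i → attach (s i) ≡ 0
  attach-s i = attach-on (cong s (p∘s i))

  attach≡0⇒on : ∀ {u} → attach u ≡ 0 → s (p u) ≡ u
  attach≡0⇒on {u} eq with s (p u) Fin.≟ u
  ... | yes on = on

  attach≤1 : ∀ u → attach u ≤ 1
  attach≤1 u with does (s (p u) Fin.≟ u)
  ... | true  = z≤n
  ... | false = s≤s z≤n

  cdist-s : ∀ u i → cdist u (s i) ≡ attach u + ∣ toℕ (p u) - toℕ i ∣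
  cdist-s u i with u Fin.≟ s i
  ... | yes refl = ≡.sym (cong₂ _+_ (attach-s i) (m≡n⇒∣m-n∣≡0 (cong toℕ (p∘s i))))
  ... | no _     = cong₂ _+_ (≡.trans (cong (attach u +_) (attach-s i)) (+-identityʳ _))
                     (cong (λ j → ∣ toℕ (p u) - toℕ j ∣) (p∘s i))

  cdist-s-s : ∀ i j → cdist (s i) (s j) ≡ ∣ toℕ i - toℕ j ∣
  cdist-s-s i j = ≡.trans (cdist-s (s i) j) (cong₂ (λ a k → a + ∣ toℕ k - toℕ j ∣) (attach-s i) (p∘s i))

  cdist-leaf : ∀ {u} → s (p u) ≢ u → cdist u (s (p u)) ≡ 1
  cdist-leaf {u} off = ≡.trans (cdist-s u (p u)) (cong₂ _+_ (attach-off off) (m≡n⇒∣m-n∣≡0 {toℕ (p u)} refl))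

  cdist-own : ∀ u → cdist u (s (p u)) ≤ 1
  cdist-own u = ≤-trans (≤-reflexive (≡.trans (cdist-s u (p u))
    (≡.trans (cong (attach u +_) (m≡n⇒∣m-n∣≡0 {toℕ (p u)} refl)) (+-identityʳ _)))) (attach≤1 u)

  cdist≤sum : ∀ u v → cdist u v ≤ attach u + attach v + ∣ toℕ (p u) - toℕ (p v) ∣
  cdist≤sum u v with does (u Fin.≟ v)
  ... | true  = z≤n
  ... | false = ≤-refl

  cdist-ident : ∀ {u v} → cdist u v ≡ 0 → u ≡ v
  cdist-ident {u} {v} eq with u Fin.≟ v
  ... | yes u≡v = u≡v
  ... | no _ = ≡.trans (≡.sym (attach≡0⇒on (m+n≡0⇒m≡0 (attach u) attach≡0)))
    (≡.trans (cong s (Fin.toℕ-injective (∣m-n∣≡0⇒m≡n (m+n≡0⇒n≡0 (attach u + attach v) eq))))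
      (attach≡0⇒on (m+n≡0⇒n≡0 (attach u) attach≡0)))
    where attach≡0 = m+n≡0⇒m≡0 (attach u + attach v) eq

  cdist-siblings : ∀ {u v} → p u ≡ p v → cdist u v ≤ 2
  cdist-siblings {u} {v} pu≡pv = ≤-trans (cdist≤sum u v)
    (+-mono-≤ (+-mono-≤ (attach≤1 u) (attach≤1 v)) (≤-reflexive (m≡n⇒∣m-n∣≡0 (cong toℕ pu≡pv))))

  cdist-triangle : ∀ u w v → cdist u v ≤ cdist u w + cdist w v
  cdist-triangle u w v = triangle (u Fin.≟ w) (w Fin.≟ v)
    where
    open ≤-Reasoning
    pu = toℕ (p u)
    pw = toℕ (p w)
    pv = toℕ (p v)
    triangle : Dec (u ≡ w) → Dec (w ≡ v) → cdist u v ≤ cdist u w + cdist w v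
    triangle (yes refl) _ = m≤n+m (cdist u v) (cdist u u)
    triangle (no _) (yes refl) = m≤m+n (cdist u v) (cdist v v)
    triangle (no u≢w) (no w≢v) = begin
      cdist u v                                                   ≤⟨ cdist≤sum u v ⟩
      attach u + attach v + ∣ pu - pv ∣
        ≤⟨ +-mono-≤ (+-mono-≤ (m≤m+n (attach u) (attach w)) (m≤n+m (attach v) (attach w))) (∣-∣-triangle pu pw pv) ⟩
      (attach u + attach w) + (attach w + attach v) + (∣ pu - pw ∣ + ∣ pw - pv ∣)
        ≡⟨ interchange (attach u + attach w) _ _ _ ⟩
      (attach u + attach w + ∣ pu - pw ∣) + (attach w + attach v + ∣ pw - pv ∣)
        ≡⟨ cong₂ _+_ (cdist-≢ u≢w) (cdist-≢ w≢v) ⟨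
      cdist u w + cdist w v                                       ∎

  cdist-back : ∀ {u v k} → cdist u v ≡ suc k → ∃ λ w → cdist u w ≡ k × adj caterpillar w v ≡ true
  cdist-back {u} {v} {k} eq with position v
  ... | leaf off = s (p v) , suc-injective (≡.trans suc≡ eq) ,
        cdist≡1⇒adj (≡.trans (cdist-sym (s (p v)) v) (cdist-leaf off))
    where
    u≢v : u ≢ v
    u≢v refl = contradiction (≡.trans (≡.sym (cdist-self u)) eq) λ ()
    suc≡ : suc (cdist u (s (p v))) ≡ cdist u v
    suc≡ = ≡.trans (cong suc (cdist-s u (p v)))
      (≡.sym (≡.trans (cdist-≢ u≢v) (cong (_+ ∣ toℕ (p u) - toℕ (p v) ∣)
        (≡.trans (cong (attach u +_) (attach-off off)) (+-comm (attach u) 1)))))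
  ... | spine j with p u Fin.≟ j
  ...   | no pu≢j with next-toward j (p u) (pu≢j ∘ ≡.sym)
  ...     | i , i~j , closer = s i
    , suc-injective (≡.trans (cong suc (cdist-s u i)) (≡.trans (≡.sym (+-suc (attach u) _))
        (≡.trans (cong (attach u +_) (≡.sym closer)) (≡.trans (≡.sym (cdist-s u j)) eq))))
    , cdist≡1⇒adj (≡.trans (cdist-s-s i j) i~j)
  -- Now `v` is the spine vertex of `u`. As `u` differs from `v`, it is a leaf there and is itself
  -- the predecessor of `v`.
  cdist-back {u} {k = k} eq | spine j | yes refl with position u
  ... | spine i  = contradiction
    (≡.trans (≡.sym (cdist-self (s i))) (≡.trans (cong (cdist (s i) ∘ s) (≡.sym (p∘s i))) eq)) λ ()
  ... | leaf off = u , ≡.trans (cdist-self u) (suc-injective (≡.trans (≡.sym (cdist-leaf off)) eq)) ,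
        cdist≡1⇒adj (cdist-leaf off)

  cdist-metric : PathMetric caterpillar cdist
  cdist-metric = record
    { self  = cdist-self
    ; ident = cdist-ident
    ; step  = λ u {w} {v} wv → ≤-trans (cdist-triangle u w v)
        (≤-reflexive (≡.trans (cong (cdist u w +_) (adj⇒cdist≡1 wv)) (+-comm _ 1)))
    ; back  = cdist-back
    }

  -- The distance from the end `s zero` of the spine, used as the level function in
  -- `levels⇒acyclic`.
  rank : V → ℕ
  rank u = attach u + toℕ (p u)

  neighbour-of-leaf : ∀ {u v} → s (p v) ≢ v → adj caterpillar v u ≡ true → u ≡ s (p v)
  neighbour-of-leaf {u} {v} off vu with u Fin.≟ v
  ... | yes refl = contradiction (≡.trans (≡.sym (cdist-self u)) (adj⇒cdist≡1 vu)) λ ()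
  ... | no u≢v = ≡.trans (≡.sym (attach≡0⇒on (m+n≡0⇒m≡0 (attach u) rest≡0)))
      (cong s (≡.sym (Fin.toℕ-injective (∣m-n∣≡0⇒m≡n (m+n≡0⇒n≡0 (attach u) rest≡0)))))
    where
    rest≡0 : attach u + ∣ toℕ (p v) - toℕ (p u) ∣ ≡ 0
    rest≡0 = suc-injective (≡.trans (cong (λ a → a + attach u + ∣ toℕ (p v) - toℕ (p u) ∣) (≡.sym (attach-off off)))
      (≡.trans (≡.sym (cdist-≢ (u≢v ∘ ≡.sym))) (adj⇒cdist≡1 vu)))

  data Edge : V → V → Set where
    along : ∀ i j → toℕ j ≡ suc (toℕ i) → Edge (s i) (s j)
    twig  : ∀ {u} → s (p u) ≢ u → Edge (s (p u)) u

  edge : ∀ {u v} → adj caterpillar u v ≡ true → Edge u v ⊎ Edge v u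
  edge {u} {v} uv with position u | position v
  ... | leaf off | _ with neighbour-of-leaf off uv
  ...   | refl = inj₂ (twig off)
  edge {u} {v} uv | spine i | leaf off with neighbour-of-leaf off (~-sym caterpillar {s i} {v} uv)
  ...   | eq = inj₁ (subst (λ x → Edge x v) (≡.sym eq) (twig off))
  edge uv | spine i | spine j
      with Equivalence.to (gap≡1⇔ (toℕ i) (toℕ j)) (≡.trans (≡.sym (cdist-s-s i j)) (adj⇒cdist≡1 uv))
  ...   | inj₁ i≡1+j = inj₂ (along j i i≡1+j)
  ...   | inj₂ j≡1+i = inj₁ (along i j j≡1+i)

  rank-s : ∀ i → rank (s i) ≡ toℕ i
  rank-s i = cong₂ (λ a j → a + toℕ j) (attach-s i) (p∘s i)

  edge-rank : ∀ {u v} → Edge u v → rank v ≡ suc (rank u)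
  edge-rank (along i j eq) = ≡.trans (rank-s j) (≡.trans eq (cong suc (≡.sym (rank-s i))))
  edge-rank (twig {u} off) = ≡.trans (cong (_+ toℕ (p u)) (attach-off off)) (cong suc (≡.sym (rank-s (p u))))

  -- Lower ends of edges lie on the spine, where `rank` is injective; this yields the uniqueness of
  -- lower neighbours.
  edge-lower-on : ∀ {u v} → Edge u v → s (p u) ≡ u
  edge-lower-on (along i _ _) = cong s (p∘s i)
  edge-lower-on (twig {u} _)  = cong s (p∘s (p u))

  acyclic : HasCycle caterpillar → ⊥
  acyclic = levels⇒acyclic caterpillar rank rank≢ unique
    where
    rank≢ : ∀ {u v} → adj caterpillar u v ≡ true → rank u ≢ rank v
    rank≢ uv eq with edge uv
    ... | inj₁ e = <⇒≢ (n<1+n _) (≡.trans eq (edge-rank e))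
    ... | inj₂ e = <⇒≢ (n<1+n _) (≡.trans (≡.sym eq) (edge-rank e))
    lower : ∀ {u v} → adj caterpillar u v ≡ true → rank u < rank v → Edge u v
    lower uv lt with edge uv
    ... | inj₁ e = e
    ... | inj₂ e = contradiction (≤-trans (≤-reflexive (≡.sym (edge-rank e))) (<⇒≤ lt)) (<-irrefl refl)
    rank-injective : ∀ {u w} → s (p u) ≡ u → s (p w) ≡ w → rank u ≡ rank w → u ≡ w
    rank-injective {u} {w} on on′ eq = ≡.trans (≡.sym on) (≡.trans (cong s (Fin.toℕ-injective
      (≡.trans (cong (_+ toℕ (p u)) (≡.sym (attach-on on))) (≡.trans eq (cong (_+ toℕ (p w)) (attach-on on′)))))) on′)
    unique : ∀ {u w v} → adj caterpillar u v ≡ true → adj caterpillar w v ≡ true →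
      rank u < rank v → rank w < rank v → u ≡ w
    unique uv wv lt lt′ with lower uv lt | lower wv lt′
    ... | e | e′ = rank-injective (edge-lower-on e) (edge-lower-on e′)
      (suc-injective (≡.trans (≡.sym (edge-rank e)) (edge-rank e′)))

  isTree : IsTree caterpillar
  isTree = (λ u v → cdist u v , ≤⇒within caterpillar cdist-metric (cdist u v) ≤-refl) , acyclic

  cdist≤ : ∀ u v → cdist u v ≤ attach u + pathEcc d (toℕ (p u))
  cdist≤ u v = ≤-trans (cdist≤sum u v) (≤-trans (≤-reflexive (+-assoc (attach u) (attach v) _))
    (+-monoʳ-≤ (attach u) gap))
    where
    gap : attach v + ∣ toℕ (p u) - toℕ (p v) ∣ ≤ pathEcc d (toℕ (p u))
    gap with s (p v) Fin.≟ v
    ... | yes _  = gap≤pathEcc (toℕ (p u)) (Fin.toℕ≤pred[n] (p v))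
    ... | no off = let 0<p , p<d = inner v off in gap<pathEcc (toℕ (p u)) (Fin.toℕ≤pred[n] (p u)) 0<p p<d

  ecc≤ : ∀ u → ecc caterpillar u ≤ attach u + pathEcc d (toℕ (p u))
  ecc≤ u = ⨆-least (dist caterpillar u) λ v →
    ≤-trans (≤-reflexive (dist≡metric caterpillar cdist-metric u v)) (cdist≤ u v)

  ecc-bound≤d : ∀ u → attach u + pathEcc d (toℕ (p u)) ≤ d
  ecc-bound≤d u with s (p u) Fin.≟ u
  ... | yes _  = ⊔-lub (Fin.toℕ≤pred[n] (p u)) (m∸n≤m d (toℕ (p u)))
  ... | no off = let 0<p , p<d = inner u off in ⊔-lub p<d (∸-monoʳ-< 0<p (<⇒≤ p<d))

  diameter≡d : diameter caterpillar ≡ d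
  diameter≡d = ≤-antisym (⨆-least (ecc caterpillar) (λ u → ≤-trans (ecc≤ u) (ecc-bound≤d u)))
    (≤-trans (≤-reflexive (≡.sym (≡.trans (dist≡metric caterpillar cdist-metric _ _)
        (≡.trans (cdist-s-s zero (fromℕ d)) (Fin.toℕ-fromℕ d)))))
      (≤-trans (⨆-upper (dist caterpillar (s zero)) (s (fromℕ d))) (⨆-upper (ecc caterpillar) (s zero))))

  s-injective : Injective _≡_ _≡_ s
  s-injective {i} {j} eq = ≡.trans (≡.sym (p∘s i)) (≡.trans (cong p eq) (p∘s j))

  adj-s⇔ : ∀ i j → adj caterpillar (s i) (s j) ≡ true ⇔ (toℕ i ≡ suc (toℕ j) ⊎ toℕ j ≡ suc (toℕ i))
  adj-s⇔ i j = mk⇔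
    (λ e → Equivalence.to (gap≡1⇔ _ _) (≡.trans (≡.sym (cdist-s-s i j)) (adj⇒cdist≡1 e)))
    (λ e → cdist≡1⇒adj (≡.trans (cdist-s-s i j) (Equivalence.from (gap≡1⇔ _ _) e)))

  deg-leaf : ∀ {v} → s (p v) ≢ v → deg caterpillar v ≡ 1
  deg-leaf {v} off = deg≡1 caterpillar v (s (p v)) (cdist≡1⇒adj (cdist-leaf off)) λ u → neighbour-of-leaf off

  -- Leaves are never attached to the two ends of the spine.
  deg-end : ∀ i j → toℕ i ≡ 0 ⊎ toℕ i ≡ d → adj caterpillar (s i) (s j) ≡ true →
    (∀ k → adj caterpillar (s i) (s k) ≡ true → k ≡ j) → deg caterpillar (s i) ≡ 1
  deg-end i j end ij unique = deg≡1 caterpillar (s i) (s j) ij neighbour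
    where
    neighbour : ∀ u → adj caterpillar (s i) u ≡ true → u ≡ s j
    neighbour u iu with position u
    ... | spine k = cong s (unique k iu)
    ... | leaf off = ⊥-elim (not-end end)
      where
      i≡pu : i ≡ p u
      i≡pu = s-injective (neighbour-of-leaf off (~-sym caterpillar {s i} {u} iu))
      not-end : toℕ i ≡ 0 ⊎ toℕ i ≡ d → ⊥
      not-end (inj₁ ≡0) = <⇒≢ (proj₁ (inner u off)) (≡.sym (≡.trans (cong toℕ (≡.sym i≡pu)) ≡0))
      not-end (inj₂ ≡d) = <⇒≢ (proj₂ (inner u off)) (≡.trans (cong toℕ (≡.sym i≡pu)) ≡d)

-- For `d = 0` the single vertex has degree 0, is not a leaf, and remains as the path. For
-- `d = suc m` both ends of the spine are leaves, and its `m` inner vertices remain.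
isCaterpillar : ∀ {n} d {s : Fin (suc d) → Fin n} {p : Fin n → Fin (suc d)} →
  Frame s p → IsCaterpillar (Attachment.caterpillar s p)
isCaterpillar zero {s} {p} F = isTree , 1 , s , s-injective
  , (λ { zero eq → contradiction
        (≡.trans (≡.sym eq) (deg≡0 caterpillar (s zero) λ u su → ~⇒≢ caterpillar {s zero} su (all-s u))) λ () })
  , (λ v _ → zero , all-s v)
  , adj-s⇔
  where
  open Frame F
  open Attachment s p
  open CaterpillarProperties F
  all-s : ∀ v → s zero ≡ v
  all-s v with position v
  ... | spine zero = refl
  ... | leaf off   = contradiction (proj₂ (inner v off)) λ ()
isCaterpillar (suc m) {s} {p} F = isTree , m , c
  , (λ eq → Fin.inject₁-injective (Fin.suc-injective (s-injective eq)))
  , (λ i → deg≢1 caterpillar (c i) (s (inject₁ (inject₁ i))) (s (suc (suc i)))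
      (Equivalence.from (adj-s⇔ _ _) (inj₁ (cong suc (≡.sym (Fin.toℕ-inject₁ (inject₁ i))))))
      (Equivalence.from (adj-s⇔ _ _) (inj₂ (cong (λ k → suc (suc k)) (≡.sym (Fin.toℕ-inject₁ i)))))
      λ eq → m≢1+n+m (toℕ i) {1}
        (≡.trans (≡.sym (≡.trans (Fin.toℕ-inject₁ (inject₁ i)) (Fin.toℕ-inject₁ i))) (cong toℕ (s-injective eq))))
  , (λ v deg≢1 → interior v (position v) deg≢1)
  , λ i j → mk⇔
      (λ e → relabel i j (Equivalence.to (adj-s⇔ _ _) e))
      (λ e → Equivalence.from (adj-s⇔ _ _) (relabel⁻ i j e))
  where
  open Attachment s p
  open CaterpillarProperties F
  c : Fin m → _
  c i = s (suc (inject₁ i))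
  relabel : ∀ (i j : Fin m) →
    1 + toℕ (inject₁ i) ≡ 2 + toℕ (inject₁ j) ⊎ 1 + toℕ (inject₁ j) ≡ 2 + toℕ (inject₁ i) →
    toℕ i ≡ 1 + toℕ j ⊎ toℕ j ≡ 1 + toℕ i
  relabel i j e rewrite Fin.toℕ-inject₁ i | Fin.toℕ-inject₁ j with e
  ... | inj₁ eq = inj₁ (suc-injective eq)
  ... | inj₂ eq = inj₂ (suc-injective eq)
  relabel⁻ : ∀ (i j : Fin m) → toℕ i ≡ 1 + toℕ j ⊎ toℕ j ≡ 1 + toℕ i →
    1 + toℕ (inject₁ i) ≡ 2 + toℕ (inject₁ j) ⊎ 1 + toℕ (inject₁ j) ≡ 2 + toℕ (inject₁ i)
  relabel⁻ i j e rewrite Fin.toℕ-inject₁ i | Fin.toℕ-inject₁ j with e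
  ... | inj₁ eq = inj₁ (cong suc eq)
  ... | inj₂ eq = inj₂ (cong suc eq)
  first-end : deg caterpillar (s zero) ≡ 1
  first-end = deg-end zero (suc zero) (inj₁ refl) (Equivalence.from (adj-s⇔ _ _) (inj₂ refl)) unique
    where
    unique : ∀ k → adj caterpillar (s zero) (s k) ≡ true → k ≡ suc zero
    unique k e with Equivalence.to (adj-s⇔ zero k) e
    ... | inj₂ k≡1 = Fin.toℕ-injective k≡1
  last-end : deg caterpillar (s (suc (fromℕ m))) ≡ 1
  last-end = deg-end (suc (fromℕ m)) (inject₁ (fromℕ m)) (inj₂ (cong suc (Fin.toℕ-fromℕ m)))
    (Equivalence.from (adj-s⇔ _ _) (inj₁ (cong suc (≡.sym (Fin.toℕ-inject₁ (fromℕ m)))))) unique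
    where
    unique : ∀ k → adj caterpillar (s (suc (fromℕ m))) (s k) ≡ true → k ≡ inject₁ (fromℕ m)
    unique k e with Equivalence.to (adj-s⇔ (suc (fromℕ m)) k) e
    ... | inj₁ eq = Fin.toℕ-injective (≡.trans (≡.sym (suc-injective eq)) (≡.sym (Fin.toℕ-inject₁ (fromℕ m))))
    ... | inj₂ eq = contradiction
            (≤-trans (≤-reflexive (≡.sym (≡.trans eq (cong (λ x → suc (suc x)) (Fin.toℕ-fromℕ m))))) (Fin.toℕ≤pred[n] k))
            (<-irrefl refl)
  interior : ∀ v → Position v → deg caterpillar v ≢ 1 → ∃ λ i → c i ≡ v
  interior v (leaf off) ≢1 = contradiction (deg-leaf off) ≢1
  interior _ (spine zero) ≢1 = contradiction first-end ≢1
  interior _ (spine (suc i)) ≢1 with view i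
  ... | ‵fromℕ     = contradiction last-end ≢1
  ... | ‵inject₁ j = j , refl

-- Comparing a tree with its caterpillar

-- Distance minus adjacency indicator, the g of the overview. The indicators add up to the degree,
-- so subtracting ξᶜ removes exactly the distances 1.
skip1 : ℕ → ℕ
skip1 0             = 0
skip1 1             = 0
skip1 (suc (suc k)) = suc (suc k)

skip1-mono : ∀ {a b} → a ≤ b → skip1 a ≤ skip1 b
skip1-mono {0}    _                   = z≤n
skip1-mono {1}    _                   = z≤n
skip1-mono {2+ a} le@(s≤s (s≤s _)) = le

skip1-≤1 : ∀ {a} → a ≤ 1 → skip1 a ≡ 0
skip1-≤1 z≤n       = refl
skip1-≤1 (s≤s z≤n) = refl

weight : ∀ {n} → Graph n → ℕ
weight G = ∑ λ v → ∑ λ u → ecc G v * skip1 (dist G v u)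

xiD≡xiC+weight : ∀ {n} (G : Graph n) → PathMetric G (dist G) → xiD G ≡ xiC G + weight G
xiD≡xiC+weight {n} G M = ≡.trans (∑-cong row) (sum-+ _ _ (allFin n))
  where
  indicator : Fin n → Fin n → ℕ
  indicator v u = if adj G v u then 1 else 0
  split : ∀ v u → dist G v u ≡ indicator v u + skip1 (dist G v u)
  split v u with adj G v u in vu
  ... | true rewrite adj⇒1 G M vu = refl
  ... | false with dist G v u in eq
  ...   | 0    = refl
  ...   | 1    = contradiction (≡.trans (≡.sym vu) (1⇒adj G M eq)) λ ()
  ...   | 2+ _ = refl
  row : ∀ v → ecc G v * totalDist G v ≡ ecc G v * deg G v + ∑ λ u → ecc G v * skip1 (dist G v u)
  row v = begin
    ecc G v * totalDist G v
      ≡⟨ cong (ecc G v *_) (≡.trans (∑-cong (split v)) (sum-+ (indicator v) _ (allFin n))) ⟩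
    ecc G v * (deg G v + ∑ λ u → skip1 (dist G v u))
      ≡⟨ *-distribˡ-+ (ecc G v) (deg G v) _ ⟩
    ecc G v * deg G v + ecc G v * ∑ (λ u → skip1 (dist G v u))
      ≡⟨ cong ((ecc G v * deg G v) +_) (sum-*ˡ (ecc G v) _ (allFin n)) ⟨
    ecc G v * deg G v + ∑ (λ u → ecc G v * skip1 (dist G v u)) ∎
    where open ≡.≡-Reasoning

xiDiff≡weight : ∀ {n} (G : Graph n) → PathMetric G (dist G) → xiDiff G ≡ ℤ.+ weight G
xiDiff≡weight G M = ≡.trans (cong (λ m → ℤ.+ m ℤ.- ℤ.+ xiC G) (xiD≡xiC+weight G M))
  (≡.trans (ℤ.m-n≡m⊖n (xiC G + weight G) (xiC G))
  (≡.trans (cong (ℤ._⊖ xiC G) (+-comm (xiC G) (weight G)))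
  (≡.trans (ℤ.⊖-≥ (m≤n+m (xiC G) (weight G))) (cong ℤ.+_ (m+n∸n≡m (weight G) (xiC G))))))

∑∑-at : ∀ {n} (m : Fin n → ℕ) (w : Fin n → Fin n) → (∑ λ v → ∑ λ u → (m v at w v) u) ≡ ∑ m
∑∑-at m w = ∑-cong λ v → ∑-at (m v) (w v)

∑∑-+ : ∀ {n} (f g : Fin n → Fin n → ℕ) →
  (∑ λ v → ∑ λ u → f v u + g v u) ≡ (∑ λ v → ∑ (f v)) + (∑ λ v → ∑ (g v))
∑∑-+ {n} f g = ≡.trans (∑-cong λ v → sum-+ (f v) (g v) (allFin n)) (sum-+ _ _ (allFin n))

-- Each vertex `v` puts `m v` on the pair (`v`, `w v`) and `m′ v` on the pair (`w′ v`, `v`);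
-- exchanging the sums collects both at `v`.
∑∑-at-both : ∀ {n} (m m′ : Fin n → ℕ) (w w′ : Fin n → Fin n) →
  (∑ λ v → ∑ λ u → (m v at w v) u + (m′ u at w′ u) v) ≡ ∑ λ v → m v + m′ v
∑∑-at-both {n} m m′ w w′ = ≡.trans (∑∑-+ (λ v → m v at w v) (λ v u → (m′ u at w′ u) v))
  (≡.trans (cong₂ _+_ (∑∑-at m w)
    (≡.trans (sum-swap (λ v u → (m′ u at w′ u) v) (allFin n) (allFin n)) (∑∑-at m′ w′)))
  (≡.sym (sum-+ m m′ (allFin n))))

-- A vertex next to the spine has its parent on the spine, so only deeper ones are charged.
ifDeep : ℕ → ℕ → ℕ
ifDeep 0      _ = 0
ifDeep 1      _ = 0
ifDeep (2+ _) m = m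

ifDeep-suc : ∀ {h h′} m → 0 < h′ → h ≡ suc h′ → ifDeep h m ≡ m
ifDeep-suc {h′ = suc _} m _ refl = refl

module Comparison {n d : ℕ} (T : Graph n) (acyclic : HasCycle T → ⊥) (M : PathMetric T (dist T))
  (diam : diameter T ≡ d) {s : Fin (suc d) → Fin n} {p : Fin n → Fin (suc d)}
  (proj : TreeFrame.Projects T acyclic M s p) where

  private
    V = Fin n
    δ = dist T

  δ≤d : ∀ u v → δ u v ≤ d
  δ≤d u v = ≤-trans (⨆-upper (δ u) v) (≤-trans (⨆-upper (ecc T) u) (≤-reflexive diam))

  open PathMetric M
  open TreeFrame T acyclic M
  open Branches {s = s} {p} proj δ≤d public
  open Levels T acyclic M
  open Frame frame
  open Attachment s p
  open CaterpillarProperties frame using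
    (attach≤1; cdist-s; cdist-metric; cdist≤sum; cdist-own; cdist-siblings; ecc≤; Position; spine; leaf; position)

  base : V → ℕ
  base u = pathEcc d (toℕ (p u))

  attach≤height : ∀ u → attach u ≤ height u
  attach≤height u with s (p u) Fin.≟ u
  ... | yes _  = z≤n
  ... | no off = off-spine⇒height>0 u off

  -- The two ends of the spine are the witnesses.
  height+base≤ecc : ∀ u → height u + base u ≤ ecc T u
  height+base≤ecc u = ≤-trans (≤-reflexive (+-distribˡ-⊔ (height u) (toℕ (p u)) _)) (⊔-lub
    (≤-trans (≤-reflexive (≡.sym (≡.trans (proj u zero) (cong (height u +_) (∣-∣-identityʳ _))))) (⨆-upper (δ u) (s zero)))
    (≤-trans (≤-reflexive (≡.sym (≡.trans (proj u (fromℕ d)) (cong (height u +_)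
        (≡.trans (cong (λ m → ∣ toℕ (p u) - m ∣) (Fin.toℕ-fromℕ d)) (m≤n⇒∣m-n∣≡n∸m (Fin.toℕ≤pred[n] (p u))))))))
      (⨆-upper (δ u) (s (fromℕ d)))))

  attach+base≤ecc : ∀ u → attach u + base u ≤ ecc T u
  attach+base≤ecc u = ≤-trans (+-monoˡ-≤ (base u) (attach≤height u)) (height+base≤ecc u)

  parentIn : V → V
  parentIn u = parent (s (p u)) u

  SiblingEdge : V → V → Set
  SiblingEdge v u = δ v u ≡ 1 × 0 < height v × 0 < height u × p v ≡ p u

  -- With one vertex on the spine or with different branches, both distances have the same form and
  -- `attach` is at most `height`. Within a branch `cdist` is at most 2, so only an edge can fail.
  cdist≤δ : ∀ v u → cdist v u ≤ δ v u ⊎ SiblingEdge v u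
  cdist≤δ v u with position v | position u
  ... | _ | spine j = inj₁ (≤-trans (≤-reflexive (cdist-s v j))
          (≤-trans (+-monoˡ-≤ _ (attach≤height v)) (≤-reflexive (≡.sym (proj v j)))))
  ... | spine i | leaf _ = inj₁ (≤-trans (≤-reflexive (≡.trans (cdist-sym (s i) u) (cdist-s u i)))
          (≤-trans (+-monoˡ-≤ _ (attach≤height u)) (≤-reflexive (≡.trans (≡.sym (proj u i)) (metric-sym T M u (s i))))))
  ... | leaf v-off | leaf u-off with p v Fin.≟ p u
  ...   | no pv≢pu = inj₁ (≤-trans (cdist≤sum v u) (≤-trans
          (+-monoˡ-≤ ∣ toℕ (p v) - toℕ (p u) ∣ (+-mono-≤ (attach≤height v) (attach≤height u)))
          (≤-reflexive (≡.trans (xy∙z≈xz∙y (height v) (height u) _) (≡.sym (cross-δ v u pv≢pu))))))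
  ...   | yes pv≡pu with δ v u in eq
  ...     | 0    = inj₁ (≤-reflexive (≡.trans (cong (cdist v) (≡.sym (ident eq))) (cdist-self v)))
  ...     | 1    = inj₂ (refl , off-spine⇒height>0 v v-off , off-spine⇒height>0 u u-off , pv≡pu)
  ...     | 2+ k = inj₁ (≤-trans (cdist-siblings {v} {u} pv≡pu) (m≤m+n 2 k))

  -- Twice `1 + base u`: a leaf has at most this eccentricity in the caterpillar, and siblings are
  -- at distance 2. The charge is for one order of the edge from `u` to its parent.
  loss : V → ℕ
  loss u = ifDeep (height u) (2 + 2 * base u)

  -- For the pairs of `u` with its spine vertex, at tree distance at least 2. The tree eccentricity
  -- is at least `2 + base u` at `u` and at least `base u` at the spine vertex. In the caterpillar
  -- both pairs weigh 0.
  gain gain′ : V → ℕ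
  gain  u = ifDeep (height u) (4 + 2 * base u)
  gain′ u = ifDeep (height u) (2 * base u)

  gain+gain′≡2loss : ∀ u → gain u + gain′ u ≡ loss u + loss u
  gain+gain′≡2loss u with height u
  ... | 0    = refl
  ... | 1    = refl
  ... | 2+ _ = cong (λ m → suc (suc m)) (shift (2 * base u))
    where
    shift : ∀ m → 2 + m + m ≡ m + (2 + m)
    shift m = +-comm (2 + m) m

  -- Seen from the spine vertex, `v` is a lower neighbour of `u` and hence the parent of `u`; as `v`
  -- is itself off the spine, `u` is deep and its charge is not cut to 0.
  child-loss : ∀ {v u} → adj T v u ≡ true → p v ≡ p u → 0 < height v → height u ≡ suc (height v) →
    parentIn u ≡ v × loss u ≡ 2 + 2 * base u
  child-loss {v} {u} vu pv≡pu 0<hv hu≡ = parent≡v , ifDeep-suc _ 0<hv hu≡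
    where
    x = s (p u)
    xu≡ : δ x u ≡ suc (δ x v)
    xu≡ = ≡.trans (metric-sym T M x u) (≡.trans hu≡ (cong suc
      (≡.trans (cong (λ i → δ v (s i)) pv≡pu) (metric-sym T M v x))))
    parent≡v : parentIn u ≡ v
    parent≡v = lower-neighbour-unique x
      (parent-adj x u λ ≡0 → contradiction (≡.trans (≡.sym xu≡) ≡0) λ ()) vu
      (≡.trans xu≡ (cong suc (≡.sym (≡.trans (parent-level x u) (cong pred xu≡))))) xu≡

  bound gains losses : V → V → ℕ
  bound  v u = (attach v + base v) * skip1 (cdist v u)
  gains  v u = (gain v at s (p v)) u + (gain′ u at s (p u)) v
  losses v u = (loss v at parentIn v) u + (loss u at parentIn u) v

  pair≤ : ∀ v u → bound v u + gains v u ≤ ecc T v * skip1 (δ v u) + losses v u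
  pair≤ v u with u Fin.≟ s (p v)
  ... | yes refl = begin
    (attach v + base v) * skip1 (cdist v u) + (gain v + (gain′ u at s (p u)) v)
      ≡⟨ cong₂ (λ a b → (attach v + base v) * a + (gain v + b)) (skip1-≤1 (cdist-own v)) zero-gain ⟩
    (attach v + base v) * 0 + (gain v + 0)
      ≡⟨ cong₂ _+_ (*-zeroʳ (attach v + base v)) (+-identityʳ (gain v)) ⟩
    gain v                             ≤⟨ gain≤ (height v) ⟩
    (height v + base v) * skip1 (height v)  ≤⟨ *-monoˡ-≤ (skip1 (height v)) (height+base≤ecc v) ⟩
    ecc T v * skip1 (δ v u)            ≤⟨ m≤m+n _ _ ⟩
    _                                  ∎
    where
    open ≤-Reasoning
    -- The second vertex lies on the spine, so its height is 0 and it has no gain of its own.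
    zero-gain : (gain′ (s (p v)) at s (p (s (p v)))) v ≡ 0
    zero-gain rewrite proj₁ (spine-projection (p v)) = at-zero (s (p (s (p v)))) v
    gain≤ : ∀ h → ifDeep h (4 + 2 * base v) ≤ (h + base v) * skip1 h
    gain≤ 0 = z≤n
    gain≤ 1 = z≤n
    gain≤ (2+ h) = begin
      4 + 2 * base v           ≡⟨ *-distribˡ-+ 2 2 (base v) ⟨
      2 * (2 + base v)         ≡⟨ *-comm 2 (2 + base v) ⟩
      (2 + base v) * 2         ≤⟨ *-mono-≤ (+-monoˡ-≤ (base v) (m≤m+n 2 h)) (m≤m+n 2 h) ⟩
      (2 + h + base v) * (2 + h) ∎
  ... | no u≢ with v Fin.≟ s (p u)
  ...   | yes refl = begin
    (attach v + base v) * skip1 (cdist v u) + gain′ u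
      ≡⟨ cong (λ a → (attach v + base v) * a + gain′ u) (skip1-≤1 (≤-trans (≤-reflexive (cdist-sym v u)) (cdist-own u))) ⟩
    (attach v + base v) * 0 + gain′ u
      ≡⟨ cong (_+ gain′ u) (*-zeroʳ (attach v + base v)) ⟩
    gain′ u                            ≤⟨ gain′≤ (height u) ⟩
    base u * skip1 (height u)          ≡⟨ cong (λ i → pathEcc d (toℕ i) * skip1 (height u)) (p∘s (p u)) ⟨
    base v * skip1 (height u)
      ≤⟨ *-monoˡ-≤ (skip1 (height u)) (≤-trans (m≤n+m (base v) (height v)) (height+base≤ecc v)) ⟩
    ecc T v * skip1 (height u)         ≡⟨ cong (λ a → ecc T v * skip1 a) (metric-sym T M u v) ⟩
    ecc T v * skip1 (δ v u)            ≤⟨ m≤m+n _ _ ⟩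
    _                                  ∎
    where
    open ≤-Reasoning
    gain′≤ : ∀ h → ifDeep h (2 * base u) ≤ base u * skip1 h
    gain′≤ 0 = z≤n
    gain′≤ 1 = z≤n
    gain′≤ (2+ h) = ≤-trans (≤-reflexive (*-comm 2 (base u))) (*-monoʳ-≤ (base u) (m≤m+n 2 h))
  ...   | no v≢ with cdist≤δ v u
  ...     | inj₁ cd≤ = +-mono-≤ (*-mono-≤ (attach+base≤ecc v) (skip1-mono cd≤)) z≤n
  ...     | inj₂ (vu≡1 , 0<hv , 0<hu , pv≡pu) = begin
    (attach v + base v) * skip1 (cdist v u) + 0  ≡⟨ +-identityʳ _ ⟩
    (attach v + base v) * skip1 (cdist v u)
      ≤⟨ *-mono-≤ (+-monoˡ-≤ (base v) (attach≤1 v)) (skip1-mono (cdist-siblings {v} {u} pv≡pu)) ⟩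
    (1 + base v) * 2                             ≡⟨ *-comm (1 + base v) 2 ⟩
    2 * (1 + base v)                             ≡⟨ *-distribˡ-+ 2 1 (base v) ⟩
    2 + 2 * base v                               ≤⟨ paid (levels-differ-by-one (s (p v)) vu) ⟩
    (loss v at parentIn v) u + (loss u at parentIn u) v  ≤⟨ m≤n+m _ (ecc T v * skip1 (δ v u)) ⟩
    _                                            ∎
    where
    open ≤-Reasoning
    vu : adj T v u ≡ true
    vu = 1⇒adj T M vu≡1
    hv≡ : δ (s (p v)) v ≡ height v
    hv≡ = metric-sym T M _ v
    hu≡ : δ (s (p v)) u ≡ height u
    hu≡ = ≡.trans (metric-sym T M _ u) (cong (λ i → δ u (s i)) pv≡pu)
    -- The end farther from the spine is the child; its loss lies on this pair in whichever order
    -- the pair is taken.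
    paid : δ (s (p v)) u ≡ suc (δ (s (p v)) v) ⊎ δ (s (p v)) v ≡ suc (δ (s (p v)) u) →
      2 + 2 * base v ≤ (loss v at parentIn v) u + (loss u at parentIn u) v
    paid (inj₁ up) with child-loss vu pv≡pu 0<hv (≡.trans (≡.sym hu≡) (≡.trans up (cong suc hv≡)))
    ... | par≡v , loss≡ = ≤-trans (≤-reflexive (≡.trans (cong (λ i → 2 + 2 * pathEcc d (toℕ i)) pv≡pu)
      (≡.trans (≡.sym loss≡) (≡.trans (≡.sym (at-same (loss u) v)) (cong (λ w → (loss u at w) v) (≡.sym par≡v))))))
      (m≤n+m _ ((loss v at parentIn v) u))
    paid (inj₂ down) with child-loss (~-sym T vu) (≡.sym pv≡pu) 0<hu (≡.trans (≡.sym hv≡) (≡.trans down (cong suc hu≡)))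
    ... | par≡u , loss≡ = ≤-trans (≤-reflexive
      (≡.trans (≡.sym loss≡) (≡.trans (≡.sym (at-same (loss v) u)) (cong (λ w → (loss v at w) u) (≡.sym par≡u)))))
      (m≤m+n _ _)

  weight≤bound : weight caterpillar ≤ ∑ λ v → ∑ (bound v)
  weight≤bound = ∑-mono λ v → ∑-mono λ u → *-mono-≤ (ecc≤ v)
    (≤-reflexive (cong skip1 (dist≡metric caterpillar cdist-metric v u)))

  ∑∑-gains : (∑ λ v → ∑ (gains v)) ≡ ∑ λ v → gain v + gain′ v
  ∑∑-gains = ∑∑-at-both gain gain′ (s ∘ p) (s ∘ p)

  ∑∑-losses : (∑ λ v → ∑ (losses v)) ≡ ∑ λ v → loss v + loss v
  ∑∑-losses = ∑∑-at-both loss loss parentIn parentIn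

  ∑∑-gains≡losses : (∑ λ v → ∑ (gains v)) ≡ (∑ λ v → ∑ (losses v))
  ∑∑-gains≡losses = ≡.trans ∑∑-gains (≡.trans (∑-cong gain+gain′≡2loss) (≡.sym ∑∑-losses))

  weight≤ : weight caterpillar ≤ weight T
  weight≤ = ≤-trans weight≤bound (+-cancelʳ-≤ (∑ λ v → ∑ (gains v)) _ _ (begin
    (∑ λ v → ∑ (bound v)) + (∑ λ v → ∑ (gains v))   ≡⟨ ∑∑-+ bound gains ⟨
    (∑ λ v → ∑ λ u → bound v u + gains v u)
      ≤⟨ ∑-mono (λ v → ∑-mono (pair≤ v)) ⟩
    (∑ λ v → ∑ λ u → cost v u + losses v u)         ≡⟨ ∑∑-+ cost losses ⟩
    weight T + (∑ λ v → ∑ (losses v))               ≡⟨ cong (weight T +_) ∑∑-gains≡losses ⟨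
    weight T + (∑ λ v → ∑ (gains v))                ∎))
    where
    open ≤-Reasoning
    cost : V → V → ℕ
    cost v u = ecc T v * skip1 (δ v u)

  xiDiff≤ : xiDiff caterpillar ℤ.≤ xiDiff T
  xiDiff≤ = ≡.subst₂ ℤ._≤_ (≡.sym (xiDiff≡weight caterpillar (dist-metric caterpillar connected)))
    (≡.sym (xiDiff≡weight T M)) (ℤ.+≤+ weight≤)
    where connected = proj₁ (CaterpillarProperties.isTree frame)

-- Minimising over finitely many frames

diameter-attained : ∀ {n} (G : Graph n) → Fin n → PathMetric G (dist G) →
  ∃ λ a → ∃ λ b → dist G a b ≡ diameter G
diameter-attained G x M = from-ecc (⨆-attained (ecc G))
  where
  from-dist : ∀ a → diameter G ≡ ecc G a → ecc G a ≡ 0 ⊎ (∃ λ b → ecc G a ≡ dist G a b) →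
    ∃ λ a → ∃ λ b → dist G a b ≡ diameter G
  from-dist a diam≡ (inj₁ ≡0)         = a , a , ≡.trans (PathMetric.self M a) (≡.sym (≡.trans diam≡ ≡0))
  from-dist a diam≡ (inj₂ (b , ecc≡)) = a , b , ≡.sym (≡.trans diam≡ ecc≡)
  from-ecc : diameter G ≡ 0 ⊎ (∃ λ a → diameter G ≡ ecc G a) → ∃ λ a → ∃ λ b → dist G a b ≡ diameter G
  from-ecc (inj₁ ≡0)          = x , x , ≡.trans (PathMetric.self M x) (≡.sym ≡0)
  from-ecc (inj₂ (a , diam≡)) = from-dist a diam≡ (⨆-attained (dist G a))

allVecs : ∀ {A : Set} → List A → ∀ k → List (Vec A k)
allVecs xs zero    = [ [] ]
allVecs xs (suc k) = cartesianProductWith _∷_ xs (allVecs xs k)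

∈-allVecs : ∀ {k m} (v : Vec (Fin m) k) → v ∈ allVecs (allFin m) k
∈-allVecs []      = here refl
∈-allVecs (x ∷ v) = ∈-cartesianProductWith⁺ _∷_ (∈-allFin x) (∈-allVecs v)

-- `Frame` speaks of `s` and `p` only and not of a tree, so the frames of given `n` and `d` can be
-- filtered out of a finite list.
frame? : ∀ {n d} (s : Fin (suc d) → Fin n) (p : Fin n → Fin (suc d)) → Dec (Frame s p)
frame? {d = d} s p = map′
  (λ { (ps , inn) → record { p∘s = ps ; inner = inn } })
  (λ F → Frame.p∘s F , Frame.inner F)
  (Fin.all? (λ i → p (s i) Fin.≟ i) ×-dec
   Fin.all? (λ u → ¬? (s (p u) Fin.≟ u) →-dec (0 <? toℕ (p u) ×-dec toℕ (p u) <? d)))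

module _ (n d : ℕ) where

  Candidate : Set
  Candidate = Vec (Fin n) (suc d) × Vec (Fin (suc d)) n

  IsFrame : Candidate → Set
  IsFrame (ss , ps) = Frame (Vec.lookup ss) (Vec.lookup ps)

  graph : Candidate → Graph n
  graph (ss , ps) = Attachment.caterpillar (Vec.lookup ss) (Vec.lookup ps)

  isFrame? : ∀ c → Dec (IsFrame c)
  isFrame? (ss , ps) = frame? (Vec.lookup ss) (Vec.lookup ps)

  candidates frames : List Candidate
  candidates = cartesianProductWith _,_ (allVecs (allFin n) (suc d)) (allVecs (allFin (suc d)) n)
  frames     = filter isFrame? candidates

  ∈-frames : ∀ c → IsFrame c → c ∈ frames
  ∈-frames (ss , ps) = ∈-filter⁺ isFrame? (∈-cartesianProductWith⁺ _,_ (∈-allVecs ss) (∈-allVecs ps))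

  best-frame : ∀ c → IsFrame c →
    ∃ λ b → IsFrame b × (∀ c′ → IsFrame c′ → xiDiff (graph b) ℤ.≤ xiDiff (graph c′))
  -- `c` is the starting value of `argmin`; since it is a frame, so is the result.
  best-frame c F = Extrema.argmin (xiDiff ∘ graph) c frames
    , Extrema.argmin-all (xiDiff ∘ graph) {c} {frames} {P = IsFrame} F (All.all-filter isFrame? candidates)
    , λ c′ F′ → All.lookup (Extrema.f[argmin]≤f[xs] {f = xiDiff ∘ graph} c frames) (∈-frames c′ F′)

  Caterpillarises : Graph n → Candidate → Set
  Caterpillarises T c = IsFrame c × xiDiff (graph c) ℤ.≤ xiDiff T

  caterpillarise : Fin n → (T : Graph n) → IsTree T → diameter T ≡ d → ∃ (Caterpillarises T)
  caterpillarise x T (connected , acyclic) diam = build (diameter-attained T x M)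
    where
    M = dist-metric T connected
    open TreeFrame T acyclic M
    frame-of : (∃ λ (ss : Vec (Fin n) (suc d)) → ∃ λ (ps : Vec (Fin (suc d)) n) →
      Projects (Vec.lookup ss) (Vec.lookup ps)) → ∃ (Caterpillarises T)
    frame-of (ss , ps , proj) = (ss , ps) , frame , xiDiff≤
      where open Comparison T acyclic M diam {Vec.lookup ss} {Vec.lookup ps} proj
    build : (∃ λ a → ∃ λ b → dist T a b ≡ diameter T) → ∃ (Caterpillarises T)
    build (a , b , ab≡) = frame-of (subst
      (λ d → ∃ λ (ss : Vec (Fin n) (suc d)) → ∃ λ (ps : Vec (Fin (suc d)) n) →
        Projects (Vec.lookup ss) (Vec.lookup ps))
      (≡.trans ab≡ diam) (projection a b))

  minimal-caterpillar : Fin n → Σ (Graph n) (λ T → IsTree T × diameter T ≡ d) →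
    Σ (Graph n) (λ C → IsCaterpillar C × diameter C ≡ d ×
      ((T : Graph n) → IsTree T → diameter T ≡ d → xiDiff C ℤ.≤ xiDiff T))
  minimal-caterpillar x (T , tree , diam) =
    let c , F , _       = caterpillarise x T tree diam
        b , Fb , minimal = best-frame c F
    in graph b , isCaterpillar d Fb , CaterpillarProperties.diameter≡d Fb
      , λ T′ tree′ diam′ → let c′ , F′ , c′≤T′ = caterpillarise x T′ tree′ diam′
                           in ℤ.≤-trans (minimal c′ F′) c′≤T′

theorem3p1 : (n d : ℕ) →
    Σ (Graph n) (λ T → IsTree T × diameter T ≡ d) →
    Σ (Graph n) (λ C → IsCaterpillar C × diameter C ≡ d ×
      ((T : Graph n) → IsTree T → diameter T ≡ d → xiDiff C ℤ.≤ xiDiff T))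
-- Without vertices every graph has `xiDiff` 0, and `T` is a caterpillar whose remaining path is
-- empty.
theorem3p1 zero d (T , tree , diam) = T
  , (tree , 0 , (λ ()) , (λ { {()} }) , (λ ()) , (λ ()) , (λ ()))
  , diam , λ _ _ _ → ℤ.≤-refl
theorem3p1 (suc n) d = minimal-caterpillar (suc n) d zero
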